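{- Let $G$ be a Dedekind $\sigma$-complete truncated $\ell$-group. Then there exist a set $X$, a $\sigma$-ideal $\mathcal{I}$ of subsets of $X$ and an injective $\sigma$-continuous $\ell$-homomorphism $\iota\colon G\hookrightarrow\frac{\mathbb{R}^X}{\mathcal{I}}$ such that, for every $f\in G$, $\iota(\overline{f})=\iota(f)\land[1]_{\mathcal{I}}$.
   Context: For an abelian $\ell$-group (lattice-ordered group) $G$, $G^+=\{x\in G\mid x\geq0\}$, $f^+=f\lor0$, $f^-=-(f\land0)$, and $\omega=\{0,1,2,\dots\}$. A truncated $\ell$-group is an abelian $\ell$-group $G$ with a unary operation $\overline{\,\cdot\,}\colon G\to G$ such that: (T1) $\overline{f}=\overline{f^+}-f^-$ for all $f\in G$; (T2) $\overline{f}\in G^+$ for all $f\in G^+$; (T3) $f\land\overline{g}\leq\overline{f}\leq f$ for all $f,g\in G^+$; (T4) for $f\in G^+$, $\overline f=0$ implies $f=0$; (T5) for $f\in G^+$, if $nf=\overline{nf}$ for every $n\in\omega$ then $f=0$. (Divisibility is not assumed.) A poset is Dedekind $\sigma$-complete if every nonempty countable subset that has an upper bound has a supremum. A map between posets is $\sigma$-continuous if it preserves all existing suprema of nonempty countable subsets. An $\ell$-homomorphism is a group homomorphism that is a lattice homomorphism. A $\sigma$-ideal of subsets of $X$ is a set $\mathcal{I}$ of subsets of $X$ containing $\emptyset$, closed under taking subsets and under countable unions ($X\in\mathcal{I}$ is allowed). $\frac{\mathbb{R}^X}{\mathcal{I}}$ is the quotient of $\mathbb{R}^X$ by the relation $f\sim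 g$ iff $\{x\in X\mid f(x)\neq g(x)\}\in\mathcal{I}$, with operations (and order) induced from the pointwise ones; $[f]_{\mathcal{I}}$ is the class of $f$, and $[1]_{\mathcal{I}}$ is the class of the constant function $1$. -}

module Defs where

open import Level using (Level; _⊔_; 0ℓ) renaming (suc to lsuc)
open import Algebra.Bundles using (AbelianGroup)
open import Algebra.Bundles.Raw using (RawGroup)
open import Algebra.Core using (Op₁; Op₂)
open import Algebra.Definitions using (Congruent₁)
import Algebra.Definitions.RawMonoid as RawMonoidDefs
open import Algebra.Lattice.Bundles.Raw using (RawLattice)
open import Algebra.Lattice.Morphism.Structures using (IsLatticeHomomorphism)
open import Algebra.Morphism.Structures using (IsGroupHomomorphism)
open import Algebra.Structures using (IsAbelianGroup)
open import Data.Nat.Base using (ℕ)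
open import Data.Product using (∃; ∃₂; _×_; _,_)
open import Data.Rational.Base as ℚ using (ℚ; 0ℚ; 1ℚ; ½)
import Data.Rational.Properties as ℚ
open import Data.Sum using (_⊎_; inj₁; inj₂)
open import Function.Base using (_∘_)
open import Function.Definitions using (Injective)
open import Relation.Binary.Core using (Rel)
open import Relation.Binary.Lattice.Structures using (IsLattice)
open import Relation.Binary.PropositionalEquality
  using (_≡_; refl; sym; trans; cong; subst; subst₂)
open import Relation.Nullary using (¬_)
open import Relation.Unary using (Pred; ∅; _∈_; _⊆_; _∪_; _∩_; ⋃)

private
  variable
    a b c i ℓ ℓ₁ ℓ₂ : Level

------------------------------------------------------------------------
-- Nonempty countable suprema

-- Nonempty countable subsets are presented as ranges of sequences
-- s : ℕ → A, possibly with repetitions.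

module _ {A : Set a} (_≤_ : Rel A ℓ) where

  IsUpperBound : (ℕ → A) → A → Set ℓ
  IsUpperBound s u = ∀ n → s n ≤ u

  IsSupremum : (ℕ → A) → A → Set (a ⊔ ℓ)
  IsSupremum s v = IsUpperBound s v × (∀ u → IsUpperBound s u → v ≤ u)

  DedekindσComplete : Set (a ⊔ ℓ)
  DedekindσComplete = ∀ s → ∃ (IsUpperBound s) → ∃ (IsSupremum s)

module _ {A : Set a} {B : Set b} (_≤₁_ : Rel A ℓ₁) (_≤₂_ : Rel B ℓ₂) where

  σContinuous : (A → B) → Set (a ⊔ b ⊔ ℓ₁ ⊔ ℓ₂)
  σContinuous h = ∀ s v → IsSupremum _≤₁_ s v → IsSupremum _≤₂_ (h ∘ s) (h v)

------------------------------------------------------------------------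
-- Truncated ℓ-groups

record AbelianℓGroup c ℓ₁ ℓ₂ : Set (lsuc (c ⊔ ℓ₁ ⊔ ℓ₂)) where
  infix  4 _≈_ _≤_
  infixl 6 _+_ _-_
  infixr 6 _∨_
  infixr 7 _∧_
  infix  8 -_ _⁺ _⁻
  field
    Carrier        : Set c
    _≈_            : Rel Carrier ℓ₁
    _≤_            : Rel Carrier ℓ₂
    _+_ _∨_ _∧_    : Op₂ Carrier
    0#             : Carrier
    -_             : Op₁ Carrier
    isAbelianGroup : IsAbelianGroup _≈_ _+_ 0# -_
    isLattice      : IsLattice _≈_ _≤_ _∨_ _∧_
    +-monoˡ-≤      : ∀ z {x y} → x ≤ y → x + z ≤ y + z

  _-_ : Op₂ Carrier
  x - y = x + - y

  _⁺ _⁻ : Op₁ Carrier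
  f ⁺ = f ∨ 0#
  f ⁻ = - (f ∧ 0#)

  abelianGroup : AbelianGroup c ℓ₁
  abelianGroup = record { isAbelianGroup = isAbelianGroup }

  rawGroup : RawGroup c ℓ₁
  rawGroup = AbelianGroup.rawGroup abelianGroup

  rawLattice : RawLattice c ℓ₁
  rawLattice = record { _≈_ = _≈_ ; _∧_ = _∧_ ; _∨_ = _∨_ }

  open RawMonoidDefs (RawGroup.rawMonoid rawGroup) public
    using () renaming (_×_ to _·_)

record TruncatedℓGroup c ℓ₁ ℓ₂ : Set (lsuc (c ⊔ ℓ₁ ⊔ ℓ₂)) where
  field
    ℓGroup : AbelianℓGroup c ℓ₁ ℓ₂
  open AbelianℓGroup ℓGroup public
  field
    trunc      : Op₁ Carrier
    trunc-cong : Congruent₁ _≈_ trunc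
    T1 : ∀ f → trunc f ≈ trunc (f ⁺) - f ⁻
    T2 : ∀ f → 0# ≤ f → 0# ≤ trunc f
    T3 : ∀ f g → 0# ≤ f → 0# ≤ g → (f ∧ trunc g ≤ trunc f) × (trunc f ≤ f)
    T4 : ∀ f → 0# ≤ f → trunc f ≈ 0# → f ≈ 0#
    T5 : ∀ f → 0# ≤ f → (∀ n → n · f ≈ trunc (n · f)) → f ≈ 0#

------------------------------------------------------------------------
-- The real numbers, as two-sided Dedekind cuts

-- `located` is locatedness in its metric form; it implies that both
-- sides of the cut are inhabited.

record ℝ : Set₁ where
  field
    L U       : Pred ℚ 0ℓ
    L-lower   : ∀ {p q} → p ℚ.≤ q → L q → L p
    U-upper   : ∀ {p q} → p ℚ.≤ q → U p → U q
    L-open    : ∀ {p} → L p → ∃ λ q → p ℚ.< q × L q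
    U-open    : ∀ {q} → U q → ∃ λ p → p ℚ.< q × U p
    separated : ∀ {p q} → L p → U q → p ℚ.< q
    located   : ∀ {ε} → 0ℚ ℚ.< ε → ∃₂ λ p q → L p × U q × q ℚ.≤ p ℚ.+ ε

open ℝ

private
  half : ∀ {ε} → 0ℚ ℚ.< ε → ∃ λ δ → 0ℚ ℚ.< δ × δ ℚ.+ δ ≡ ε
  half {ε} 0<ε = ½ ℚ.* ε
    , ℚ.positive⁻¹ (½ ℚ.* ε) {{ℚ.pos*pos⇒pos ½ ε {{ℚ.positive 0<ε}}}}
    , trans (sym (ℚ.*-distribʳ-+ ε ½ ½)) (ℚ.*-identityˡ ε)

  interchange : ∀ p q r s → (p ℚ.+ q) ℚ.+ (r ℚ.+ s) ≡ (p ℚ.+ r) ℚ.+ (q ℚ.+ s)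
  interchange p q r s =
    trans (ℚ.+-assoc p q (r ℚ.+ s))
    (trans (cong (p ℚ.+_) (trans (sym (ℚ.+-assoc q r s))
                          (trans (cong (ℚ._+ s) (ℚ.+-comm q r)) (ℚ.+-assoc r q s))))
    (sym (ℚ.+-assoc p r (q ℚ.+ s))))

  cancel-mid : ∀ p q → (p ℚ.- q) ℚ.+ q ≡ p
  cancel-mid p q =
    trans (ℚ.+-assoc p (ℚ.- q) q)
    (trans (cong (p ℚ.+_) (ℚ.+-inverseˡ q)) (ℚ.+-identityʳ p))

  cancel-end : ∀ p q → (p ℚ.+ q) ℚ.- q ≡ p
  cancel-end p q =
    trans (ℚ.+-assoc p q (ℚ.- q))
    (trans (cong (p ℚ.+_) (ℚ.+-inverseʳ q)) (ℚ.+-identityʳ p))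

  neg-neg : ∀ p → ℚ.- (ℚ.- p) ≡ p
  neg-neg p =
    trans (sym (ℚ.+-identityʳ (ℚ.- (ℚ.- p))))
    (trans (cong (ℚ.- (ℚ.- p) ℚ.+_) (sym (ℚ.+-inverseˡ p)))
    (trans (sym (ℚ.+-assoc (ℚ.- (ℚ.- p)) (ℚ.- p) p))
    (trans (cong (ℚ._+ p) (ℚ.+-inverseˡ (ℚ.- p))) (ℚ.+-identityˡ p))))

  <-+pos : ∀ p {δ} → 0ℚ ℚ.< δ → p ℚ.< p ℚ.+ δ
  <-+pos p {δ} 0<δ = subst (ℚ._< p ℚ.+ δ) (ℚ.+-identityʳ p) (ℚ.+-monoʳ-< p 0<δ)

  <-pos : ∀ p {δ} → 0ℚ ℚ.< δ → p ℚ.- δ ℚ.< p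
  <-pos p {δ} 0<δ = subst (p ℚ.- δ ℚ.<_) (cancel-mid p δ) (<-+pos (p ℚ.- δ) 0<δ)

infix  4 _≤ℝ_ _≃ℝ_
infixl 6 _+ℝ_
infixr 6 _∨ℝ_
infixr 7 _∧ℝ_
infix  8 -ℝ_

_≤ℝ_ _≃ℝ_ : Rel ℝ 0ℓ
x ≤ℝ y = L x ⊆ L y
x ≃ℝ y = x ≤ℝ y × y ≤ℝ x

fromℚ : ℚ → ℝ
fromℚ r .L p = p ℚ.< r
fromℚ r .U q = r ℚ.< q
fromℚ r .L-lower p≤q q<r = ℚ.≤-<-trans p≤q q<r
fromℚ r .U-upper p≤q r<p = ℚ.<-≤-trans r<p p≤q
fromℚ r .L-open p<r = let m , p<m , m<r = ℚ.<-dense p<r in m , p<m , m<r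
fromℚ r .U-open r<q = let m , r<m , m<q = ℚ.<-dense r<q in m , m<q , r<m
fromℚ r .separated p<r r<q = ℚ.<-trans p<r r<q
fromℚ r .located 0<ε =
  let δ , 0<δ , δ+δ≡ε = half 0<ε in
  r ℚ.- δ , r ℚ.+ δ , <-pos r 0<δ , <-+pos r 0<δ ,
  ℚ.≤-reflexive (trans (cong (ℚ._+ δ) (sym (cancel-mid r δ)))
                (trans (ℚ.+-assoc (r ℚ.- δ) δ δ) (cong (r ℚ.- δ ℚ.+_) δ+δ≡ε)))

0ℝ 1ℝ : ℝ
0ℝ = fromℚ 0ℚ
1ℝ = fromℚ 1ℚ

_+ℝ_ : Op₂ ℝ
(x +ℝ y) .L r = ∃₂ λ p q → L x p × L y q × r ≡ p ℚ.+ q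
(x +ℝ y) .U r = ∃₂ λ p q → U x p × U y q × r ≡ p ℚ.+ q
(x +ℝ y) .L-lower {r} {s} r≤s (p , q , Lp , Lq , s≡) =
  r ℚ.- q , q ,
  L-lower x (subst (r ℚ.- q ℚ.≤_) (trans (cong (ℚ._- q) s≡) (cancel-end p q))
              (ℚ.+-monoˡ-≤ (ℚ.- q) r≤s)) Lp ,
  Lq , sym (cancel-mid r q)
(x +ℝ y) .U-upper {r} {s} r≤s (p , q , Up , Uq , r≡) =
  s ℚ.- q , q ,
  U-upper x (subst (ℚ._≤ s ℚ.- q) (trans (cong (ℚ._- q) r≡) (cancel-end p q))
              (ℚ.+-monoˡ-≤ (ℚ.- q) r≤s)) Up ,
  Uq , sym (cancel-mid s q)
(x +ℝ y) .L-open (p , q , Lp , Lq , refl) =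
  let p′ , p<p′ , Lp′ = L-open x Lp in
  p′ ℚ.+ q , ℚ.+-monoˡ-< q p<p′ , p′ , q , Lp′ , Lq , refl
(x +ℝ y) .U-open (p , q , Up , Uq , refl) =
  let p′ , p′<p , Up′ = U-open x Up in
  p′ ℚ.+ q , ℚ.+-monoˡ-< q p′<p , p′ , q , Up′ , Uq , refl
(x +ℝ y) .separated (p , q , Lp , Lq , refl) (r , s , Ur , Us , refl) =
  ℚ.+-mono-< (separated x Lp Ur) (separated y Lq Us)
(x +ℝ y) .located 0<ε =
  let δ , 0<δ , δ+δ≡ε = half 0<ε
      p , q , Lp , Uq , q≤p+δ = located x 0<δ
      r , s , Lr , Us , s≤r+δ = located y 0<δ
  in p ℚ.+ r , q ℚ.+ s , (p , r , Lp , Lr , refl) , (q , s , Uq , Us , refl) ,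
     ℚ.≤-trans (ℚ.+-mono-≤ q≤p+δ s≤r+δ)
       (ℚ.≤-reflexive (trans (interchange p δ r δ) (cong (p ℚ.+ r ℚ.+_) δ+δ≡ε)))

-ℝ_ : Op₁ ℝ
(-ℝ x) .L p = U x (ℚ.- p)
(-ℝ x) .U q = L x (ℚ.- q)
(-ℝ x) .L-lower p≤q = U-upper x (ℚ.neg-antimono-≤ p≤q)
(-ℝ x) .U-upper p≤q = L-lower x (ℚ.neg-antimono-≤ p≤q)
(-ℝ x) .L-open {p} Up =
  let q , q<-p , Uq = U-open x Up in
  ℚ.- q , subst (ℚ._< ℚ.- q) (neg-neg p) (ℚ.neg-antimono-< q<-p) ,
  subst (U x) (sym (neg-neg q)) Uq
(-ℝ x) .U-open {q} Lq =
  let p , -q<p , Lp = L-open x Lq in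
  ℚ.- p , subst (ℚ.- p ℚ.<_) (neg-neg q) (ℚ.neg-antimono-< -q<p) ,
  subst (L x) (sym (neg-neg p)) Lp
(-ℝ x) .separated {p} {q} Up Lq =
  subst₂ ℚ._<_ (neg-neg p) (neg-neg q) (ℚ.neg-antimono-< (separated x Lq Up))
(-ℝ x) .located {ε} 0<ε =
  let p , q , Lp , Uq , q≤p+ε = located x 0<ε in
  ℚ.- q , ℚ.- p , subst (U x) (sym (neg-neg q)) Uq , subst (L x) (sym (neg-neg p)) Lp ,
  subst (ℚ._≤ ℚ.- q ℚ.+ ε)
    (trans (cong (ℚ._+ ε) (ℚ.neg-distrib-+ p ε))
      (trans (ℚ.+-assoc (ℚ.- p) (ℚ.- ε) ε)
        (trans (cong (ℚ.- p ℚ.+_) (ℚ.+-inverseˡ ε)) (ℚ.+-identityʳ (ℚ.- p)))))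
    (ℚ.+-monoˡ-≤ ε (ℚ.neg-antimono-≤ q≤p+ε))

_∨ℝ_ : Op₂ ℝ
(x ∨ℝ y) .L = L x ∪ L y
(x ∨ℝ y) .U = U x ∩ U y
(x ∨ℝ y) .L-lower p≤q (inj₁ Lq) = inj₁ (L-lower x p≤q Lq)
(x ∨ℝ y) .L-lower p≤q (inj₂ Lq) = inj₂ (L-lower y p≤q Lq)
(x ∨ℝ y) .U-upper p≤q (Ux , Uy) = U-upper x p≤q Ux , U-upper y p≤q Uy
(x ∨ℝ y) .L-open (inj₁ Lp) = let q , p<q , Lq = L-open x Lp in q , p<q , inj₁ Lq
(x ∨ℝ y) .L-open (inj₂ Lp) = let q , p<q , Lq = L-open y Lp in q , p<q , inj₂ Lq
(x ∨ℝ y) .U-open (Ux , Uy) with U-open x Ux | U-open y Uy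
... | p , p<q , Up | r , r<q , Ur with ℚ.≤-total p r
...   | inj₁ p≤r = r , r<q , U-upper x p≤r Up , Ur
...   | inj₂ r≤p = p , p<q , Up , U-upper y r≤p Ur
(x ∨ℝ y) .separated (inj₁ Lp) (Ux , _) = separated x Lp Ux
(x ∨ℝ y) .separated (inj₂ Lp) (_ , Uy) = separated y Lp Uy
(x ∨ℝ y) .located 0<ε with located x 0<ε | located y 0<ε
... | p , q , Lp , Uq , q≤ | r , s , Lr , Us , s≤ with ℚ.≤-total q s
...   | inj₁ q≤s = r , s , inj₂ Lr , (U-upper x q≤s Uq , Us) , s≤
...   | inj₂ s≤q = p , q , inj₁ Lp , (Uq , U-upper y s≤q Us) , q≤

_∧ℝ_ : Op₂ ℝ
(x ∧ℝ y) .L = L x ∩ L y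
(x ∧ℝ y) .U = U x ∪ U y
(x ∧ℝ y) .L-lower p≤q (Lx , Ly) = L-lower x p≤q Lx , L-lower y p≤q Ly
(x ∧ℝ y) .U-upper p≤q (inj₁ Up) = inj₁ (U-upper x p≤q Up)
(x ∧ℝ y) .U-upper p≤q (inj₂ Up) = inj₂ (U-upper y p≤q Up)
(x ∧ℝ y) .L-open (Lx , Ly) with L-open x Lx | L-open y Ly
... | q , p<q , Lq | s , p<s , Ls with ℚ.≤-total q s
...   | inj₁ q≤s = q , p<q , Lq , L-lower y q≤s Ls
...   | inj₂ s≤q = s , p<s , L-lower x s≤q Lq , Ls
(x ∧ℝ y) .U-open (inj₁ Uq) = let p , p<q , Up = U-open x Uq in p , p<q , inj₁ Up
(x ∧ℝ y) .U-open (inj₂ Uq) = let p , p<q , Up = U-open y Uq in p , p<q , inj₂ Up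
(x ∧ℝ y) .separated (Lx , _) (inj₁ Uq) = separated x Lx Uq
(x ∧ℝ y) .separated (_ , Ly) (inj₂ Uq) = separated y Ly Uq
(x ∧ℝ y) .located 0<ε with located x 0<ε | located y 0<ε
... | p , q , Lp , Uq , q≤ | r , s , Lr , Us , s≤ with ℚ.≤-total p r
...   | inj₁ p≤r = p , q , (Lp , L-lower y p≤r Lr) , inj₁ Uq , q≤
...   | inj₂ r≤p = r , s , (L-lower x r≤p Lp , Lr) , inj₂ Us , s≤

------------------------------------------------------------------------
-- σ-ideals and the quotient of ℝ^X by a σ-ideal

-- Under excluded middle every predicate is equivalent to one valued in
-- the lowest universe, so `Pred X 0ℓ` comprises all subsets of X.

record σIdeal (X : Set a) i : Set (a ⊔ lsuc 0ℓ ⊔ lsuc i) where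
  field
    𝓘        : Pred (Pred X 0ℓ) i
    ∅-closed : ∅ ∈ 𝓘
    ⊆-closed : ∀ {A B : Pred X 0ℓ} → A ⊆ B → B ∈ 𝓘 → A ∈ 𝓘
    ⋃-closed : ∀ (A : ℕ → Pred X 0ℓ) → (∀ n → A n ∈ 𝓘) → ⋃ ℕ A ∈ 𝓘

-- An element of the quotient is given by a representative X → ℝ, with _∼_ as
-- equality and _≲_ as the induced order.  That these are an equivalence and a
-- compatible partial order uses excluded middle (for instance, {f ≠ h} is
-- contained in {f ≠ g} ∪ {g ≠ h}), so only raw bundles are formed here.

module Quotient {X : Set a} (I : σIdeal X i) where
  open σIdeal I

  infix 4 _∼_ _≲_

  _∼_ _≲_ : Rel (X → ℝ) i
  f ∼ g = (λ x → ¬ (f x ≃ℝ g x)) ∈ 𝓘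
  f ≲ g = (λ x → ¬ (f x ≤ℝ g x)) ∈ 𝓘

  _+_ _∨_ _∧_ : Op₂ (X → ℝ)
  (f + g) x = f x +ℝ g x
  (f ∨ g) x = f x ∨ℝ g x
  (f ∧ g) x = f x ∧ℝ g x

  -_ : Op₁ (X → ℝ)
  (- f) x = -ℝ f x

  [0] [1] : X → ℝ
  [0] _ = 0ℝ
  [1] _ = 1ℝ

  rawGroup : RawGroup (a ⊔ lsuc 0ℓ) i
  rawGroup = record { _≈_ = _∼_ ; _∙_ = _+_ ; ε = [0] ; _⁻¹ = -_ }

  rawLattice : RawLattice (a ⊔ lsuc 0ℓ) i
  rawLattice = record { _≈_ = _∼_ ; _∧_ = _∧_ ; _∨_ = _∨_ }

record IsσEmbedding (G : TruncatedℓGroup c ℓ₁ ℓ₂) {X : Set a} (I : σIdeal X i)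
                    (ι : TruncatedℓGroup.Carrier G → X → ℝ)
                    : Set (a ⊔ c ⊔ i ⊔ ℓ₁ ⊔ ℓ₂ ⊔ lsuc 0ℓ) where
  private
    module G = TruncatedℓGroup G
    module Q = Quotient I
  field
    isGroupHomomorphism   : IsGroupHomomorphism G.rawGroup Q.rawGroup ι
    isLatticeHomomorphism : IsLatticeHomomorphism G.rawLattice Q.rawLattice ι
    injective             : Injective G._≈_ Q._∼_ ι
    σ-continuous          : σContinuous G._≤_ Q._≲_ ι
    trunc-homo            : ∀ f → ι (G.trunc f) Q.∼ ι f Q.∧ Q.[1]

{-# OPTIONS --safe #-}
-- A point of X codes an arbitrary function x : G → ℝ, and ι f x = x f.  Call a relation any instance
-- of "x preserves the operations at f, g and the supremum v of s"; the σ-ideal consists of the sets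
-- covered by countably many failures of relations, so that ι is trivially a σ-continuous homomorphism.
-- Injectivity amounts to finding, for f ≰ g and countably many relations, a point that satisfies all
-- of them and has x f > x g.  By (T5) some n (f − g)⁺ dominates an element u > 0 that behaves like an
-- indicator function.  With the elements 0 < p ≤ u as forcing conditions, p ⊩ y meaning that p is
-- disjoint from the negative part of y, the argument of Rasiowa and Sikorski gives a descending
-- sequence of conditions which locates the countably many relevant elements between consecutive
-- multiples of u (by the Archimedean property) and preserves the given suprema.  The elements forced to
-- be nonnegative form a cone P, and x y is the real number with lower cut { m / n | n y − m u ∈ P }.
-- No ultrafilter, hence no choice beyond excluded middle, is needed.

module Submission where

open import Defs
open import Level using (Level; _⊔_; 0ℓ) renaming (suc to lsuc)
open import Algebra.Bundles using (AbelianGroup)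
import Algebra.Properties.AbelianGroup as AbelianGroupProperties
import Algebra.Properties.CommutativeMonoid.Mult as Mult
import Algebra.Properties.CommutativeSemigroup as CommutativeSemigroupProperties
open import Axiom.ExcludedMiddle using (ExcludedMiddle)
open import Data.Bool.Base using (Bool; T)
open import Data.Empty using (⊥-elim)
open import Data.Fin.Base using (Fin; zero; suc)
open import Data.Integer.Base as ℤ using (ℤ; +_; -[1+_]; +[1+_]; 0ℤ; 1ℤ; _⊖_)
import Data.Integer.Properties as ℤ
open import Data.Nat.Base as ℕ using (ℕ; zero; suc)
import Data.Nat.Properties as ℕ
open import Data.Product using (Σ-syntax; _×_; _,_; ∃; proj₁; proj₂)
open import Data.Rational.Base as ℚ using (ℚ; 0ℚ; 1ℚ; mkℚ; toℚᵘ; fromℚᵘ)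
import Data.Rational.Properties as ℚ
open import Data.Rational.Unnormalised.Base as ℚᵘ
  using (mkℚᵘ; 0ℚᵘ; 1ℚᵘ; ↥_; ↧_; ↧ₙ_; *≤*; *<*; *≡*)
import Data.Rational.Unnormalised.Properties as ℚᵘ
open import Data.Sum.Base using (_⊎_; inj₁; inj₂)
open import Data.Vec.Base using (Vec; []; _∷_; lookup; replicate; zipWith; map; allFin)
open import Data.Vec.N-ary using (N-ary; Eq; curryⁿ; curryⁿ-cong; _$ⁿ_)
open import Function.Base using (_∘_)
open import Relation.Binary.Lattice.Structures using (IsLattice)
open import Relation.Binary.PropositionalEquality as ≡ using (_≡_)
import Relation.Binary.Reasoning.Setoid as SetoidReasoning
open import Relation.Nullary using (¬_; yes; no)
open import Relation.Nullary.Decidable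
  using (True; toWitness; fromWitness; isYes; decidable-stable)
open import Relation.Unary using (Pred; _∈_)

-- Enumeration of pairs of natural numbers

-- Walks ℕ × ℕ along the antidiagonals.
unpair : ℕ → ℕ × ℕ
unpair zero    = 0 , 0
unpair (suc k) with unpair k
... | m , zero  = 0 , suc m
... | m , suc n = suc m , n

unpair-surjective : ∀ m n → ∃ λ k → unpair k ≡ (m , n)
unpair-surjective m n = along m n (start (m ℕ.+ n))
  where
  along : ∀ m n → (∃ λ k → unpair k ≡ (0 , m ℕ.+ n)) → ∃ λ k → unpair k ≡ (m , n)
  along zero    n s = s
  along (suc m) n s with along m (suc n) (≡.subst (λ i → ∃ λ k → unpair k ≡ (0 , i)) (≡.sym (ℕ.+-suc m n)) s)
  ... | k , eq = suc k , step
    where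
    step : unpair (suc k) ≡ (suc m , n)
    step rewrite eq = ≡.refl
  start : ∀ s → ∃ λ k → unpair k ≡ (0 , s)
  start zero    = 0 , ≡.refl
  start (suc s) with along s 0 (≡.subst (λ i → ∃ λ k → unpair k ≡ (0 , i)) (≡.sym (ℕ.+-identityʳ s)) (start s))
  ... | k , eq = suc k , step
    where
    step : unpair (suc k) ≡ (0 , suc s)
    step rewrite eq = ≡.refl

-- Integer multiples in abelian groups and a solver for linear identities

module IntegerMultiples {c ℓ} (A : AbelianGroup c ℓ) where

  open AbelianGroup A
    renaming (_∙_ to _+_; ε to 0#; _⁻¹ to -_; ∙-cong to +-cong; ∙-congˡ to +-congˡ; ∙-congʳ to +-congʳ;
              comm to +-comm; identityˡ to +-identityˡ; identityʳ to +-identityʳ;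
              inverseˡ to +-inverseˡ; inverseʳ to +-inverseʳ; ⁻¹-cong to -‿cong)
  open AbelianGroupProperties A
    renaming (⁻¹-∙-comm to -‿+-comm; ε⁻¹≈ε to -0≈0; inverseˡ-unique to -‿unique)
  open CommutativeSemigroupProperties commutativeSemigroup using (interchange)
  open Mult commutativeMonoid public using ()
    renaming (_×_ to _·_; ×-congʳ to ·-congʳ; ×-homo-+ to ·-homo-+; ×-distrib-+ to ·-distrib-+; ×-assocˡ to ·-assocˡ)
  open SetoidReasoning setoid

  infixr 8 _•_

  _•_ : ℤ → Carrier → Carrier
  (+ n)    • x = n · x
  -[1+ n ] • x = - (suc n · x)

  •-congˡ : ∀ {w z x} → w ≡ z → w • x ≈ z • x
  •-congˡ ≡.refl = refl

  •-⊖ : ∀ m n x → (m ⊖ n) • x ≈ m · x - n · x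
  •-⊖ m       zero    x = sym (trans (+-congˡ -0≈0) (+-identityʳ _))
  •-⊖ zero    (suc n) x = sym (+-identityˡ _)
  •-⊖ (suc m) (suc n) x = begin
    (suc m ⊖ suc n) • x              ≈⟨ •-congˡ (ℤ.[1+m]⊖[1+n]≡m⊖n m n) ⟩
    (m ⊖ n) • x                      ≈⟨ •-⊖ m n x ⟩
    m · x - n · x                    ≈⟨ +-identityˡ _ ⟨
    0# + (m · x - n · x)             ≈⟨ +-congʳ (+-inverseʳ x) ⟨
    (x - x) + (m · x - n · x)        ≈⟨ interchange x (- x) (m · x) (- (n · x)) ⟩
    (x + m · x) + (- x + - (n · x))  ≈⟨ +-congˡ (-‿+-comm x (n · x)) ⟩
    suc m · x - suc n · x            ∎

  •-homo-+ : ∀ w z x → (w ℤ.+ z) • x ≈ w • x + z • x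
  •-homo-+ (+ m)    (+ n)    x = ·-homo-+ x m n
  •-homo-+ (+ m)    -[1+ n ] x = •-⊖ m (suc n) x
  •-homo-+ -[1+ m ] (+ n)    x = trans (•-⊖ n (suc m) x) (+-comm _ _)
  •-homo-+ -[1+ m ] -[1+ n ] x = begin
    - (suc (suc (m ℕ.+ n)) · x)       ≡⟨ ≡.cong (λ k → - (suc k · x)) (ℕ.+-suc m n) ⟨
    - ((suc m ℕ.+ suc n) · x)         ≈⟨ -‿cong (·-homo-+ x (suc m) (suc n)) ⟩
    - (suc m · x + suc n · x)         ≈⟨ -‿+-comm _ _ ⟨
    - (suc m · x) + - (suc n · x)     ∎

  •-homo-neg : ∀ z x → (ℤ.- z) • x ≈ - (z • x)
  •-homo-neg z x = -‿unique _ _ (begin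
    (ℤ.- z) • x + z • x   ≈⟨ •-homo-+ (ℤ.- z) z x ⟨
    (ℤ.- z ℤ.+ z) • x     ≈⟨ •-congˡ (ℤ.+-inverseˡ z) ⟩
    0#                    ∎)

  •-homo-* : ∀ n z x → (+ n ℤ.* z) • x ≈ n · (z • x)
  •-homo-* zero    z x = refl
  •-homo-* (suc n) z x = begin
    (+ suc n ℤ.* z) • x         ≈⟨ •-congˡ (ℤ.suc-* (+ n) z) ⟩
    (z ℤ.+ + n ℤ.* z) • x       ≈⟨ •-homo-+ z (+ n ℤ.* z) x ⟩
    z • x + (+ n ℤ.* z) • x     ≈⟨ +-congˡ (•-homo-* n z x) ⟩
    z • x + n · (z • x)         ∎

  module Solver where

    infixl 6 _⊕_ _⊝_
    infix  8 ⊖_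

    data Expr (n : ℕ) : Set where
      var : Fin n → Expr n
      _⊕_ : Expr n → Expr n → Expr n
      ⊖_  : Expr n → Expr n
      𝟘   : Expr n

    _⊝_ : ∀ {n} → Expr n → Expr n → Expr n
    e ⊝ f = e ⊕ ⊖ f

    ⟦_⟧ : ∀ {n} → Expr n → Vec Carrier n → Carrier
    ⟦ var i ⟧ ρ = lookup ρ i
    ⟦ e ⊕ f ⟧ ρ = ⟦ e ⟧ ρ + ⟦ f ⟧ ρ
    ⟦ ⊖ e ⟧   ρ = - ⟦ e ⟧ ρ
    ⟦ 𝟘 ⟧     ρ = 0#

    combination : ∀ {n} → Vec ℤ n → Vec Carrier n → Carrier
    combination []      []      = 0#
    combination (z ∷ v) (x ∷ ρ) = z • x + combination v ρ

    unit : ∀ {n} → Fin n → Vec ℤ n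
    unit zero    = 1ℤ ∷ replicate _ 0ℤ
    unit (suc i) = 0ℤ ∷ unit i

    coefficients : ∀ {n} → Expr n → Vec ℤ n
    coefficients (var i) = unit i
    coefficients (e ⊕ f) = zipWith ℤ._+_ (coefficients e) (coefficients f)
    coefficients (⊖ e)   = map ℤ.-_ (coefficients e)
    coefficients 𝟘       = replicate _ 0ℤ

    combination-0 : ∀ {n} (ρ : Vec Carrier n) → combination (replicate n 0ℤ) ρ ≈ 0#
    combination-0 []      = refl
    combination-0 (x ∷ ρ) = trans (+-identityˡ _) (combination-0 ρ)

    combination-unit : ∀ {n} i (ρ : Vec Carrier n) → combination (unit i) ρ ≈ lookup ρ i
    combination-unit zero    (x ∷ ρ) = trans (+-cong (+-identityʳ x) (combination-0 ρ)) (+-identityʳ x)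
    combination-unit (suc i) (x ∷ ρ) = trans (+-identityˡ _) (combination-unit i ρ)

    combination-+ : ∀ {n} (v w : Vec ℤ n) ρ →
      combination (zipWith ℤ._+_ v w) ρ ≈ combination v ρ + combination w ρ
    combination-+ []      []      []      = sym (+-identityˡ 0#)
    combination-+ (y ∷ v) (z ∷ w) (x ∷ ρ) =
      trans (+-cong (•-homo-+ y z x) (combination-+ v w ρ)) (interchange _ _ _ _)

    combination-neg : ∀ {n} (v : Vec ℤ n) ρ → combination (map ℤ.-_ v) ρ ≈ - combination v ρ
    combination-neg []      []      = sym -0≈0
    combination-neg (z ∷ v) (x ∷ ρ) =
      trans (+-cong (•-homo-neg z x) (combination-neg v ρ)) (-‿+-comm _ _)

    correct : ∀ {n} (e : Expr n) ρ → combination (coefficients e) ρ ≈ ⟦ e ⟧ ρ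
    correct (var i) ρ = combination-unit i ρ
    correct (e ⊕ f) ρ = trans (combination-+ (coefficients e) _ ρ) (+-cong (correct e ρ) (correct f ρ))
    correct (⊖ e)   ρ = trans (combination-neg (coefficients e) ρ) (-‿cong (correct e ρ))
    correct 𝟘       ρ = combination-0 ρ

    infix 4 _⊜_

    _⊜_ : ∀ {n} → Expr n → Expr n → Expr n × Expr n
    _⊜_ = _,_

    equation : ∀ n → N-ary n (Expr n) (Expr n × Expr n) → Expr n × Expr n
    equation n f = f $ⁿ map var (allFin n)

    -- Both sides equal the integer combinations given by their coefficient vectors. These vectors
    -- are closed terms, so `refl` settles the hypothesis in each use.
    solve : ∀ n (f : N-ary n (Expr n) (Expr n × Expr n)) →
            coefficients (proj₁ (equation n f)) ≡ coefficients (proj₂ (equation n f)) →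
            Eq n _≈_ (curryⁿ ⟦ proj₁ (equation n f) ⟧) (curryⁿ ⟦ proj₂ (equation n f) ⟧)
    solve n f eq = curryⁿ-cong _≈_ ⟦ e₁ ⟧ ⟦ e₂ ⟧ λ ρ →
      trans (sym (correct e₁ ρ)) (trans (reflexive (≡.cong (λ v → combination v ρ) eq)) (correct e₂ ρ))
      where
      e₁ = proj₁ (equation n f)
      e₂ = proj₂ (equation n f)

-- Order, disjointness and the Archimedean property in abelian ℓ-groups

module ℓGroupProperties {c ℓ₁ ℓ₂} (G : AbelianℓGroup c ℓ₁ ℓ₂) where

  open AbelianℓGroup G
  open AbelianGroup abelianGroup public
    using (setoid; refl; reflexive; sym; trans)
    renaming (∙-cong to +-cong; ∙-congˡ to +-congˡ; ∙-congʳ to +-congʳ; comm to +-comm;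
              identityˡ to +-identityˡ; identityʳ to +-identityʳ; inverseʳ to +-inverseʳ; ⁻¹-cong to -‿cong)
  open IsLattice isLattice public
    using (x≤x∨y; y≤x∨y; ∨-least; x∧y≤x; x∧y≤y; ∧-greatest; antisym)
    renaming (refl to ≤-refl; reflexive to ≤-reflexive; trans to ≤-trans)
  open IntegerMultiples abelianGroup public hiding (_·_)
  open Solver public using (solve; _⊜_; _⊕_; _⊝_; ⊖_; 𝟘)

  -- Normal form for linear reasoning: a goal is reduced to a known inequality with the same
  -- difference of sides, and the equation of differences goes to the solver.
  ≤-shift : ∀ {w x y z} → w ≤ x → z - y ≈ x - w → y ≤ z
  ≤-shift {w} {x} {y} {z} w≤x eq =
    ≤-trans (≤-reflexive (solve 2 (λ w y → y ⊜ w ⊕ (y ⊝ w)) ≡.refl w y))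
    (≤-trans (+-monoˡ-≤ (y - w) w≤x)
    (≤-reflexive
      (trans (solve 3 (λ x y w → x ⊕ (y ⊝ w) ⊜ (x ⊝ w) ⊕ y) ≡.refl x y w)
      (trans (+-congʳ (sym eq)) (solve 2 (λ y z → (z ⊝ y) ⊕ y ⊜ z) ≡.refl y z)))))

  +-mono-≤ : ∀ {w x y z} → w ≤ x → y ≤ z → w + y ≤ x + z
  +-mono-≤ {w} {x} {y} {z} w≤x y≤z = ≤-trans (+-monoˡ-≤ y w≤x)
    (≤-shift y≤z (solve 3 (λ x y z → (x ⊕ z) ⊝ (x ⊕ y) ⊜ z ⊝ y) ≡.refl x y z))

  ≤-shift₂ : ∀ {w x w′ x′ y z} → w ≤ x → w′ ≤ x′ → z - y ≈ (x - w) + (x′ - w′) → y ≤ z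
  ≤-shift₂ {w} {x} {w′} {x′} w≤x w′≤x′ eq = ≤-shift (+-mono-≤ w≤x w′≤x′)
    (trans eq (solve 4 (λ w x w′ x′ → (x ⊝ w) ⊕ (x′ ⊝ w′) ⊜ (x ⊕ x′) ⊝ (w ⊕ w′)) ≡.refl w x w′ x′))

  neg-antimono-≤ : ∀ {x y} → x ≤ y → - y ≤ - x
  neg-antimono-≤ {x} {y} x≤y = ≤-shift x≤y (solve 2 (λ x y → ⊖ x ⊝ ⊖ y ⊜ y ⊝ x) ≡.refl x y)

  x≤x+y : ∀ {x y} → 0# ≤ y → x ≤ x + y
  x≤x+y {x} {y} 0≤y = ≤-shift 0≤y (solve 2 (λ x y → (x ⊕ y) ⊝ x ⊜ y ⊝ 𝟘) ≡.refl x y)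

  +-nonneg : ∀ {x y} → 0# ≤ x → 0# ≤ y → 0# ≤ x + y
  +-nonneg 0≤x 0≤y = ≤-trans 0≤x (x≤x+y 0≤y)

  x≤y⇒0≤y-x : ∀ {x y} → x ≤ y → 0# ≤ y - x
  x≤y⇒0≤y-x {x} {y} x≤y = ≤-shift x≤y (solve 2 (λ x y → (y ⊝ x) ⊝ 𝟘 ⊜ y ⊝ x) ≡.refl x y)

  y-x≤0⇒y≤x : ∀ {x y} → y - x ≤ 0# → y ≤ x
  y-x≤0⇒y≤x {x} {y} le = ≤-shift le (solve 2 (λ x y → x ⊝ y ⊜ 𝟘 ⊝ (y ⊝ x)) ≡.refl x y)

  x≤x⁺ : ∀ x → x ≤ x ⁺
  x≤x⁺ x = x≤x∨y x 0#

  0≤x⁺ : ∀ x → 0# ≤ x ⁺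
  0≤x⁺ x = y≤x∨y x 0#

  ⁺-mono-≤ : ∀ {x y} → x ≤ y → x ⁺ ≤ y ⁺
  ⁺-mono-≤ {y = y} x≤y = ∨-least (≤-trans x≤y (x≤x⁺ y)) (0≤x⁺ y)

  ·-mono-≤ : ∀ n {x y} → x ≤ y → n · x ≤ n · y
  ·-mono-≤ zero    x≤y = ≤-refl
  ·-mono-≤ (suc n) x≤y = +-mono-≤ x≤y (·-mono-≤ n x≤y)

  ·-nonneg : ∀ n {x} → 0# ≤ x → 0# ≤ n · x
  ·-nonneg zero    0≤x = ≤-refl
  ·-nonneg (suc n) 0≤x = +-nonneg 0≤x (·-nonneg n 0≤x)

  ·-homo-- : ∀ n x y → n · (x - y) ≈ n · x - n · y
  ·-homo-- n x y =
    trans (solve 2 (λ z w → z ⊜ (z ⊕ w) ⊝ w) ≡.refl (n · (x - y)) (n · y))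
    (+-congʳ (trans (sym (·-distrib-+ (x - y) y n))
                    (·-congʳ n (solve 2 (λ x y → (x ⊝ y) ⊕ y ⊜ x) ≡.refl x y))))

  ·-zeroʳ : ∀ n → n · 0# ≈ 0#
  ·-zeroʳ zero    = refl
  ·-zeroʳ (suc n) = trans (+-identityˡ _) (·-zeroʳ n)

  ·-homo-neg : ∀ n x → n · (- x) ≈ - (n · x)
  ·-homo-neg zero    x = solve 0 (𝟘 ⊜ ⊖ 𝟘) ≡.refl
  ·-homo-neg (suc n) x = trans (+-congˡ (·-homo-neg n x))
    (solve 2 (λ x y → ⊖ x ⊕ ⊖ y ⊜ ⊖ (x ⊕ y)) ≡.refl x (n · x))

  infix 4 _⟂_

  _⟂_ : Carrier → Carrier → Set ℓ₂
  x ⟂ y = x ∧ y ≤ 0#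

  ⟂-mono : ∀ {w x y z} → w ≤ x → y ≤ z → x ⟂ z → w ⟂ y
  ⟂-mono w≤x y≤z = ≤-trans (∧-greatest (≤-trans (x∧y≤x _ _) w≤x) (≤-trans (x∧y≤y _ _) y≤z))

  ⟂-sym : ∀ {x y} → x ⟂ y → y ⟂ x
  ⟂-sym = ≤-trans (∧-greatest (x∧y≤y _ _) (x∧y≤x _ _))

  ⟂-≤ : ∀ {x y} → x ⟂ y → x ≤ y → x ≤ 0#
  ⟂-≤ x⟂y x≤y = ≤-trans (∧-greatest ≤-refl x≤y) x⟂y

  -- Subtracting `w ∧ y` from the left-hand side `z` leaves something below `w`, since `w ∧ y` is
  -- nonnegative, and below `x`, since `z - x` is below both `w` and `y`.
  ∧-subdistrib-+ : ∀ {w x y} → 0# ≤ w → 0# ≤ x → 0# ≤ y → w ∧ (x + y) ≤ (w ∧ x) + (w ∧ y)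
  ∧-subdistrib-+ {w} {x} {y} 0≤w 0≤x 0≤y = ≤-shift below (solve 3 (λ p q z → (p ⊕ q) ⊝ z ⊜ p ⊝ (z ⊝ q)) ≡.refl (w ∧ x) (w ∧ y) z)
    where
    z = w ∧ (x + y)
    below : z - (w ∧ y) ≤ w ∧ x
    below = ∧-greatest
      (≤-shift₂ (x∧y≤x w (x + y)) (∧-greatest 0≤w 0≤y)
        (solve 3 (λ w z q → w ⊝ (z ⊝ q) ⊜ (w ⊝ z) ⊕ (q ⊝ 𝟘)) ≡.refl w z (w ∧ y)))
      (≤-shift {w = z - x} {x = w ∧ y}
        (∧-greatest
          (≤-shift₂ (x∧y≤x w (x + y)) 0≤x (solve 3 (λ w z x → w ⊝ (z ⊝ x) ⊜ (w ⊝ z) ⊕ (x ⊝ 𝟘)) ≡.refl w z x))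
          (≤-shift (x∧y≤y w (x + y)) (solve 3 (λ x y z → y ⊝ (z ⊝ x) ⊜ (x ⊕ y) ⊝ z) ≡.refl x y z)))
        (solve 3 (λ x z q → x ⊝ (z ⊝ q) ⊜ q ⊝ (z ⊝ x)) ≡.refl x z (w ∧ y)))

  ⟂-+ : ∀ {w x y} → 0# ≤ w → 0# ≤ x → 0# ≤ y → w ⟂ x → w ⟂ y → w ⟂ x + y
  ⟂-+ 0≤w 0≤x 0≤y w⟂x w⟂y =
    ≤-trans (∧-subdistrib-+ 0≤w 0≤x 0≤y) (≤-trans (+-mono-≤ w⟂x w⟂y) (≤-reflexive (+-identityˡ 0#)))

  ⟂-· : ∀ n {w x} → 0# ≤ w → 0# ≤ x → w ⟂ x → w ⟂ n · x
  ⟂-· zero    0≤w 0≤x w⟂x = x∧y≤y _ _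
  ⟂-· (suc n) 0≤w 0≤x w⟂x = ⟂-+ 0≤w 0≤x (·-nonneg n 0≤x) w⟂x (⟂-· n 0≤w 0≤x w⟂x)

  ∧-complements-⟂ : ∀ x y → x - (x ∧ y) ⟂ y - (x ∧ y)
  ∧-complements-⟂ x y = ≤-shift (∧-greatest (unshift (x∧y≤x _ _)) (unshift (x∧y≤y _ _)))
    (solve 2 (λ v z → 𝟘 ⊝ v ⊜ z ⊝ (v ⊕ z)) ≡.refl v z)
    where
    z = x ∧ y
    v = (x - z) ∧ (y - z)
    unshift : ∀ {w} → v ≤ w - z → v + z ≤ w
    unshift {w} v≤ = ≤-shift v≤ (solve 3 (λ v w z → w ⊝ (v ⊕ z) ⊜ (w ⊝ z) ⊝ v) ≡.refl v w z)

  x⁺≈x+[-x]⁺ : ∀ x → x ⁺ ≈ x + (- x) ⁺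
  x⁺≈x+[-x]⁺ x = antisym
    (∨-least (x≤x+y (0≤x⁺ (- x)))
      (≤-shift (x≤x⁺ (- x)) (solve 2 (λ x n → (x ⊕ n) ⊝ 𝟘 ⊜ n ⊝ ⊖ x) ≡.refl x ((- x) ⁺))))
    (≤-shift {w = (- x) ⁺} {x = x ⁺ - x}
      (∨-least
        (≤-shift (0≤x⁺ x) (solve 2 (λ x p → (p ⊝ x) ⊝ ⊖ x ⊜ p ⊝ 𝟘) ≡.refl x (x ⁺)))
        (x≤y⇒0≤y-x (x≤x⁺ x)))
      (solve 3 (λ x p n → p ⊝ (x ⊕ n) ⊜ (p ⊝ x) ⊝ n) ≡.refl x (x ⁺) ((- x) ⁺)))

  -- When the meet `v` is subtracted from `(- x) ⁺`, the result still bounds `- x` and `0#` from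
  -- above, hence also `(- x) ⁺` itself.
  x⁺⟂[-x]⁺ : ∀ x → x ⁺ ⟂ (- x) ⁺
  x⁺⟂[-x]⁺ x = ≤-shift below (solve 2 (λ v n → 𝟘 ⊝ v ⊜ (n ⊝ v) ⊝ n) ≡.refl v ((- x) ⁺))
    where
    v = x ⁺ ∧ (- x) ⁺
    v≤x+n : v ≤ x + (- x) ⁺
    v≤x+n = ≤-trans (x∧y≤x _ _) (≤-reflexive (x⁺≈x+[-x]⁺ x))
    below : (- x) ⁺ ≤ (- x) ⁺ - v
    below = ∨-least
      (≤-shift v≤x+n (solve 3 (λ x v n → (n ⊝ v) ⊝ ⊖ x ⊜ (x ⊕ n) ⊝ v) ≡.refl x v ((- x) ⁺)))
      (x≤y⇒0≤y-x (x∧y≤y _ _))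

  -- `x ⁺` lies below `n · w`, yet it is disjoint from it because it lies below `y ⁺`. This turns
  -- forced inequalities into actual ones.
  ⟂-dominated : ∀ n {w x y} → 0# ≤ w → w ⟂ y ⁺ → x ≤ y → x ≤ n · w → x ≤ 0#
  ⟂-dominated n {w} {x} {y} 0≤w w⟂y⁺ x≤y x≤nw = ≤-trans (x≤x⁺ x)
    (⟂-≤ (⟂-mono (⁺-mono-≤ x≤y) ≤-refl (⟂-· n (0≤x⁺ y) 0≤w (⟂-sym w⟂y⁺)))
         (∨-least x≤nw (·-nonneg n 0≤w)))

  -- Once `n · z` is subtracted, the two bounds are multiples of the complements `x - z` and
  -- `y - z`; these are disjoint, and so are their multiples.
  ≤-·-∧ : ∀ n {w x y} → w ≤ n · x → w ≤ n · y → w ≤ n · (x ∧ y)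
  ≤-·-∧ n {w} {x} {y} w≤nx w≤ny = y-x≤0⇒y≤x (≤-trans (∧-greatest (below w≤nx) (below w≤ny)) n[x-z]⟂n[y-z])
    where
    z = x ∧ y
    below : ∀ {v} → w ≤ n · v → w - n · z ≤ n · (v - z)
    below {v} w≤nv = ≤-trans (+-monoˡ-≤ (- (n · z)) w≤nv) (≤-reflexive (sym (·-homo-- n v z)))
    0≤x-z = x≤y⇒0≤y-x (x∧y≤x x y)
    0≤y-z = x≤y⇒0≤y-x (x∧y≤y x y)
    n[x-z]⟂n[y-z] : n · (x - z) ⟂ n · (y - z)
    n[x-z]⟂n[y-z] = ⟂-· n (·-nonneg n 0≤x-z) 0≤y-z
      (⟂-sym (⟂-· n 0≤y-z 0≤x-z (⟂-sym (∧-complements-⟂ x y))))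

  -- Since n (y m ∧ y k) ≤ (n − 1) (y m) + y k, the infimum over k lowers n by one.
  infimum-· : ∀ n {w} (y : ℕ → Carrier) → (∀ x → (∀ k → x ≤ y k) → x ≤ 0#) →
              (∀ k → w ≤ n · y k) → w ≤ 0#
  infimum-· zero    y inf w≤ = w≤ 0
  infimum-· (suc n) {w} y inf w≤ = infimum-· n y inf λ m → y-x≤0⇒y≤x (inf _ (λ k →
    ≤-shift (≤-trans (≤-·-∧ (suc n) (w≤ m) (w≤ k)) (+-mono-≤ (x∧y≤y (y m) (y k)) (·-mono-≤ n (x∧y≤x (y m) (y k)))))
      (solve 3 (λ p q w → p ⊝ (w ⊝ q) ⊜ (p ⊕ q) ⊝ w) ≡.refl (y k) (n · y m) w)))

  supremum-gap : ∀ {s v} → IsSupremum _≤_ s v → ∀ x → (∀ k → x ≤ v - s k) → x ≤ 0#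
  supremum-gap {s} {v} (_ , least) x x≤ = ≤-shift (least (v - x) λ k → ≤-shift (x≤ k)
      (solve 3 (λ v x t → (v ⊝ x) ⊝ t ⊜ (v ⊝ t) ⊝ x) ≡.refl v x (s k)))
    (solve 2 (λ v x → 𝟘 ⊝ x ⊜ (v ⊝ x) ⊝ v) ≡.refl v x)

  -- If `s` is the supremum of the multiples, the bound for `suc n` puts `x` below the gap
  -- `s - n · x`, and the gaps have no positive lower bound.
  archimedean : DedekindσComplete _≤_ → ∀ {x y} → (∀ n → n · x ≤ y) → x ≤ 0#
  archimedean complete {x} {y} nx≤y =
    let s , sup = complete (_· x) (y , nx≤y) in
    supremum-gap sup x λ n → ≤-shift (proj₁ sup (suc n))
      (solve 3 (λ s x z → (s ⊝ z) ⊝ x ⊜ s ⊝ (x ⊕ z)) ≡.refl s x (n · x))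

  x∧0≈-[-x]⁺ : ∀ x → x ∧ 0# ≈ - ((- x) ⁺)
  x∧0≈-[-x]⁺ x = antisym
    (≤-shift {x = - (x ∧ 0#)} (∨-least (neg-antimono-≤ (x∧y≤x x 0#))
        (≤-shift (x∧y≤y x 0#) (solve 1 (λ z → ⊖ z ⊝ 𝟘 ⊜ 𝟘 ⊝ z) ≡.refl (x ∧ 0#))))
      (solve 2 (λ n z → ⊖ n ⊝ z ⊜ ⊖ z ⊝ n) ≡.refl ((- x) ⁺) (x ∧ 0#)))
    (∧-greatest
      (≤-shift (x≤x⁺ (- x)) (solve 2 (λ x n → x ⊝ ⊖ n ⊜ n ⊝ ⊖ x) ≡.refl x ((- x) ⁺)))
      (≤-shift (0≤x⁺ (- x)) (solve 1 (λ n → 𝟘 ⊝ ⊖ n ⊜ n ⊝ 𝟘) ≡.refl ((- x) ⁺))))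

  -- Subtracting `(- x) ⁺` from the meet `e` brings it below `x` and `y`, hence below `0#`. So `e`
  -- lies below both of the disjoint elements `x ⁺` and `(- x) ⁺`.
  ⁺-⟂ : ∀ {x y} → x ⟂ y → x ⁺ ⟂ y
  ⁺-⟂ {x} {y} x⟂y = ≤-trans (∧-greatest (x∧y≤x _ _) e≤[-x]⁺) (x⁺⟂[-x]⁺ x)
    where
    e = x ⁺ ∧ y
    e-n≤x : e - (- x) ⁺ ≤ x
    e-n≤x = ≤-shift (≤-trans (x∧y≤x (x ⁺) y) (≤-reflexive (x⁺≈x+[-x]⁺ x)))
      (solve 3 (λ x e n → x ⊝ (e ⊝ n) ⊜ (x ⊕ n) ⊝ e) ≡.refl x e ((- x) ⁺))
    e≤[-x]⁺ : e ≤ (- x) ⁺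
    e≤[-x]⁺ = y-x≤0⇒y≤x (≤-trans (∧-greatest e-n≤x
      (≤-shift₂ (x∧y≤y (x ⁺) y) (0≤x⁺ (- x)) (solve 3 (λ y e n → y ⊝ (e ⊝ n) ⊜ (y ⊝ e) ⊕ (n ⊝ 𝟘)) ≡.refl y e ((- x) ⁺))))
      x⟂y)

-- Elements that act as indicator functions for the truncation

module TruncationUnits
  (em : ∀ ℓ → ExcludedMiddle ℓ) {c ℓ₁ ℓ₂} (G : TruncatedℓGroup c ℓ₁ ℓ₂)
  (complete : DedekindσComplete (TruncatedℓGroup._≤_ G))
  where

  open TruncatedℓGroup G
  open ℓGroupProperties ℓGroup

  -- Indicator functions: on the band generated by such a u, truncation is the meet with u.
  record IsTruncationUnit (u : Carrier) : Set ℓ₂ where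
    field
      0≤u           : 0# ≤ u
      u≤trunc-u     : u ≤ trunc u
      trunc-[n·u]≤u : ∀ n → trunc (n · u) ≤ u

  trunc-≤ : ∀ {x} → 0# ≤ x → trunc x ≤ x
  trunc-≤ {x} 0≤x = proj₂ (T3 x x 0≤x 0≤x)

  private
    -- For nonnegative functions truncated at `1` this is `(p - 1) ⁺`, with support `{p > 1}`.
    residue : Carrier → Carrier
    residue p = p - trunc p

    residue-nonneg : ∀ {p} → 0# ≤ p → 0# ≤ residue p
    residue-nonneg {p} 0≤p = x≤y⇒0≤y-x (trunc-≤ 0≤p)

    -- `(w - t) ∧ h + t` lies below `p` and below `w`, so (T3) puts it below `t`. Hence `w - t` is
    -- disjoint from `h`, while it is at most `k · h`. The bound makes the supremum of the truncated
    -- multiples exist.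
    trunc-·-residue : ∀ {p} → 0# ≤ p → ∀ k → trunc (k · residue p) ≤ trunc p
    trunc-·-residue {p} 0≤p k = y-x≤0⇒y≤x (⟂-dominated k 0≤h h⟂[w-t]⁺ ≤-refl w-t≤kh)
      where
      h = residue p
      t = trunc p
      w = trunc (k · h)
      0≤h = residue-nonneg 0≤p
      0≤kh = ·-nonneg k 0≤h
      w-t≤kh : w - t ≤ k · h
      w-t≤kh = ≤-shift₂ (trunc-≤ 0≤kh) (T2 p 0≤p)
        (solve 3 (λ x w t → x ⊝ (w ⊝ t) ⊜ (x ⊝ w) ⊕ (t ⊝ 𝟘)) ≡.refl (k · h) w t)
      h⟂[w-t]⁺ : h ⟂ (w - t) ⁺
      h⟂[w-t]⁺ = ⟂-sym (⁺-⟂ (≤-shift {w = (w - t) ∧ h + t} {x = t}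
        (≤-trans (∧-greatest
            (≤-shift (x∧y≤y (w - t) h) (solve 3 (λ e t p → p ⊝ (e ⊕ t) ⊜ (p ⊝ t) ⊝ e) ≡.refl ((w - t) ∧ h) t p))
            (≤-shift (x∧y≤x (w - t) h) (solve 3 (λ e t w → w ⊝ (e ⊕ t) ⊜ (w ⊝ t) ⊝ e) ≡.refl ((w - t) ∧ h) t w)))
          (proj₁ (T3 p (k · h) 0≤p 0≤kh)))
        (solve 2 (λ e t → 𝟘 ⊝ e ⊜ t ⊝ (e ⊕ t)) ≡.refl ((w - t) ∧ h) t)))

    -- Otherwise every multiple of `d` would equal its truncation, and (T5) would give `d ≈ 0#`.
    residue-nonzero : ∀ {d} → 0# ≤ d → ¬ (d ≤ 0#) → ∃ λ n → ¬ (residue (n · d) ≤ 0#)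
    residue-nonzero {d} 0≤d d≰0 with em _ {∃ λ n → ¬ (residue (n · d) ≤ 0#)}
    ... | yes found = found
    ... | no none = ⊥-elim (d≰0 (≤-reflexive (T5 d 0≤d λ n → antisym
            (y-x≤0⇒y≤x (decidable-stable (em _) λ ≰0 → none (n , ≰0)))
            (trunc-≤ (·-nonneg n 0≤d)))))

  module _ {h} (0≤h : 0# ≤ h) {u} (sup : IsSupremum _≤_ (λ k → trunc (k · h)) u) where

    private
      t : ℕ → Carrier
      t k = trunc (k · h)

      ub    = proj₁ sup
      least = proj₂ sup

      0≤t : ∀ k → 0# ≤ t k
      0≤t k = T2 (k · h) (·-nonneg k 0≤h)

      0≤u : 0# ≤ u
      0≤u = ≤-trans (0≤t 0) (ub 0)

      -- `w - v` lies below `m · t k`, hence below `(m ℕ.* k) · h`, and it lies below `w`. By (T3)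
      -- it is then below `t (m ℕ.* k)`, a term of the supremum `u`. Taking the infimum over `k`
      -- later removes the right-hand side.
      trunc-m·u-u≤ : ∀ m k → trunc (m · u) - u ≤ m · (u - t k)
      trunc-m·u-u≤ m k = ≤-shift {w = w - v} {x = u}
          (≤-trans (∧-greatest w-v≤mkh w-v≤w)
            (≤-trans (proj₁ (T3 ((m ℕ.* k) · h) (m · u) (·-nonneg (m ℕ.* k) 0≤h) 0≤mu)) (ub (m ℕ.* k))))
          (solve 3 (λ u w v → v ⊝ (w ⊝ u) ⊜ u ⊝ (w ⊝ v)) ≡.refl u w v)
        where
        w = trunc (m · u)
        v = m · (u - t k)
        0≤mu = ·-nonneg m 0≤u
        w-v≤w : w - v ≤ w
        w-v≤w = ≤-shift (·-nonneg m (x≤y⇒0≤y-x (ub k)))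
          (solve 2 (λ w v → w ⊝ (w ⊝ v) ⊜ v ⊝ 𝟘) ≡.refl w v)
        w-v≤mkh : w - v ≤ (m ℕ.* k) · h
        w-v≤mkh = ≤-trans (+-mono-≤ (trunc-≤ 0≤mu) (≤-reflexive (-‿cong (·-homo-- m u (t k)))))
          (≤-trans (≤-reflexive (solve 2 (λ x y → x ⊝ (x ⊝ y) ⊜ y) ≡.refl (m · u) (m · t k)))
          (≤-trans (·-mono-≤ m (trunc-≤ (·-nonneg k 0≤h)))
                   (≤-reflexive (·-assocˡ h m k))))

    supremum-isTruncationUnit : IsTruncationUnit u
    supremum-isTruncationUnit = record
      { 0≤u           = 0≤u
      ; u≤trunc-u     = least _ λ k →
          ≤-trans (∧-greatest (ub k) ≤-refl) (proj₁ (T3 u (k · h) 0≤u (·-nonneg k 0≤h)))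
      ; trunc-[n·u]≤u = λ m → y-x≤0⇒y≤x (infimum-· m (λ k → u - t k) (supremum-gap sup) (trunc-m·u-u≤ m))
      }

    supremum≤0⇒≤0 : u ≤ 0# → h ≤ 0#
    supremum≤0⇒≤0 u≤0 = ≤-trans (≤-reflexive (sym (+-identityʳ h)))
      (≤-reflexive (T4 (1 · h) (·-nonneg 1 0≤h) (antisym (≤-trans (ub 1) u≤0) (0≤t 1))))

  -- The supremum of the truncated multiples of residue p represents the indicator function of {p > 1}.
  truncation-unit : ∀ {d} → 0# ≤ d → ¬ (d ≤ 0#) →
    Σ[ u ∈ Carrier ] IsTruncationUnit u × ¬ (u ≤ 0#) × ∃ λ n → u ≤ n · d
  truncation-unit {d} 0≤d d≰0 =
    let n , h≰0 = residue-nonzero 0≤d d≰0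
        0≤p = ·-nonneg n 0≤d
        0≤h = residue-nonneg 0≤p
        bounded = trunc-·-residue 0≤p
        u , sup = complete (λ k → trunc (k · residue (n · d))) (trunc (n · d) , bounded)
    in u , supremum-isTruncationUnit 0≤h sup , (λ u≤0 → h≰0 (supremum≤0⇒≤0 0≤h sup u≤0)) , n ,
       ≤-trans (proj₂ sup _ bounded) (trunc-≤ 0≤p)

  trunc-decomposition : ∀ x → trunc x ≈ trunc (x ⁺) - (- x) ⁺
  trunc-decomposition x = trans (T1 x) (+-congˡ (-‿cong
    (trans (-‿cong (x∧0≈-[-x]⁺ x)) (solve 1 (λ n → ⊖ ⊖ n ⊜ n) ≡.refl ((- x) ⁺)))))

  module _ {u} (isUnit : IsTruncationUnit u) where

    open IsTruncationUnit isUnit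

    -- By `trunc-decomposition` it is enough that `v + (- x) ⁺` lies below `trunc (x ⁺)`. It lies
    -- below `x ⁺` and below `u ≤ trunc u`, so (T3) applies.
    ∧-unit≤trunc : ∀ x → x ∧ u ≤ trunc x
    ∧-unit≤trunc x = ≤-trans
      (≤-shift {w = v + (- x) ⁺} {x = trunc (x ⁺)}
        (≤-trans (∧-greatest v+n≤x⁺ v+n≤trunc-u) (proj₁ (T3 (x ⁺) u (0≤x⁺ x) 0≤u)))
        (solve 3 (λ t n v → (t ⊝ n) ⊝ v ⊜ t ⊝ (v ⊕ n)) ≡.refl (trunc (x ⁺)) ((- x) ⁺) v))
      (≤-reflexive (sym (trunc-decomposition x)))
      where
      v = x ∧ u
      v+n≤x⁺ : v + (- x) ⁺ ≤ x ⁺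
      v+n≤x⁺ = ≤-trans (+-monoˡ-≤ _ (x∧y≤x x u)) (≤-reflexive (sym (x⁺≈x+[-x]⁺ x)))
      v+n≤trunc-u : v + (- x) ⁺ ≤ trunc u
      v+n≤trunc-u = ≤-trans (≤-shift {w = (- x) ⁺} {x = u - v} (∨-least
          (≤-shift₂ (x∧y≤x x u) 0≤u (solve 3 (λ x v u → (u ⊝ v) ⊝ ⊖ x ⊜ (x ⊝ v) ⊕ (u ⊝ 𝟘)) ≡.refl x v u))
          (x≤y⇒0≤y-x (x∧y≤y x u)))
        (solve 3 (λ u v n → u ⊝ (v ⊕ n) ⊜ (u ⊝ v) ⊝ n) ≡.refl u v ((- x) ⁺))) u≤trunc-u

    -- It suffices that `e + z ≤ z`. The sum lies below `trunc (x ⁺)`, hence below `x ⁺`. As each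
    -- summand is at most `u`, it also lies below `2 · u`, and (T3) puts it below
    -- `trunc (2 · u) ≤ u`.
    trunc-∧-⟂-unit : ∀ x → trunc x - (x ∧ u) ⟂ u
    trunc-∧-⟂-unit x = ≤-shift {w = e + z} {x = z}
        (∧-greatest (≤-trans e+z≤t (trunc-≤ (0≤x⁺ x)))
          (≤-trans (≤-trans (∧-greatest e+z≤2u e+z≤t) (proj₁ (T3 (2 · u) (x ⁺) (·-nonneg 2 0≤u) (0≤x⁺ x))))
                   (trunc-[n·u]≤u 2)))
        (solve 2 (λ e z → 𝟘 ⊝ e ⊜ z ⊝ (e ⊕ z)) ≡.refl e z)
      where
      z = x ⁺ ∧ u
      n = (- x) ⁺
      v = x ∧ u
      t = trunc (x ⁺)
      e = (trunc x - v) ∧ u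
      z-n≤v : z - n ≤ v
      z-n≤v = ∧-greatest
        (≤-trans (+-monoˡ-≤ (- n) (≤-trans (x∧y≤x (x ⁺) u) (≤-reflexive (x⁺≈x+[-x]⁺ x))))
                 (≤-reflexive (solve 2 (λ x n → (x ⊕ n) ⊝ n ⊜ x) ≡.refl x n)))
        (≤-shift₂ (x∧y≤y (x ⁺) u) (0≤x⁺ (- x)) (solve 3 (λ u z n → u ⊝ (z ⊝ n) ⊜ (u ⊝ z) ⊕ (n ⊝ 𝟘)) ≡.refl u z n))
      e≤t-n-v : e ≤ (t - n) - v
      e≤t-n-v = ≤-trans (x∧y≤x _ _) (≤-reflexive (+-congʳ (trunc-decomposition x)))
      e+z≤t : e + z ≤ t
      e+z≤t = ≤-shift₂ e≤t-n-v z-n≤v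
        (solve 5 (λ e z t n v → t ⊝ (e ⊕ z) ⊜ (((t ⊝ n) ⊝ v) ⊝ e) ⊕ (v ⊝ (z ⊝ n))) ≡.refl e z t n v)
      e+z≤2u : e + z ≤ 2 · u
      e+z≤2u = ≤-trans (+-mono-≤ (x∧y≤y _ u) (x∧y≤y (x ⁺) u))
        (+-mono-≤ ≤-refl (≤-reflexive (sym (+-identityʳ u))))

-- Forcing with the nonzero elements below a unit

module Forcing
  (em : ∀ ℓ → ExcludedMiddle ℓ) {c ℓ₁ ℓ₂} (G : AbelianℓGroup c ℓ₁ ℓ₂)
  (complete : DedekindσComplete (AbelianℓGroup._≤_ G))
  (u : AbelianℓGroup.Carrier G)
  where

  open AbelianℓGroup G
  open ℓGroupProperties G

  record Condition : Set (c ⊔ ℓ₂) where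
    field
      el      : Carrier
      nonneg  : 0# ≤ el
      nonzero : ¬ (el ≤ 0#)
      el≤u    : el ≤ u

  open Condition

  infix 4 _⊑_ _⊩_

  _⊑_ : Condition → Condition → Set ℓ₂
  q ⊑ p = el q ≤ el p

  -- In a function lattice: x ≥ 0 wherever p > 0.
  _⊩_ : Condition → Carrier → Set ℓ₂
  p ⊩ x = el p ⟂ (- x) ⁺

  ⊩-mono : ∀ p {x y} → x ≤ y → p ⊩ x → p ⊩ y
  ⊩-mono p x≤y = ⟂-mono ≤-refl (⁺-mono-≤ (neg-antimono-≤ x≤y))

  ⊩-⊑ : ∀ p q x → q ⊑ p → p ⊩ x → q ⊩ x
  ⊩-⊑ p q x q⊑p = ⟂-mono q⊑p ≤-refl

  ⊩-nonneg : ∀ p {x} → 0# ≤ x → p ⊩ x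
  ⊩-nonneg p {x} 0≤x = ≤-trans (x∧y≤y _ _)
    (∨-least (≤-shift 0≤x (solve 1 (λ x → 𝟘 ⊝ ⊖ x ⊜ x ⊝ 𝟘) ≡.refl x)) ≤-refl)

  ⊩-+ : ∀ p {x y} → p ⊩ x → p ⊩ y → p ⊩ x + y
  ⊩-+ p {x} {y} p⊩x p⊩y = ⟂-mono ≤-refl
    (∨-least
      (≤-shift₂ (x≤x⁺ (- x)) (x≤x⁺ (- y))
        (solve 4 (λ x y m n → (m ⊕ n) ⊝ ⊖ (x ⊕ y) ⊜ (m ⊝ ⊖ x) ⊕ (n ⊝ ⊖ y)) ≡.refl x y ((- x) ⁺) ((- y) ⁺)))
      (+-nonneg (0≤x⁺ (- x)) (0≤x⁺ (- y))))
    (⟂-+ (nonneg p) (0≤x⁺ (- x)) (0≤x⁺ (- y)) p⊩x p⊩y)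

  ⊩-∧0 : ∀ p {x} → p ⊩ x → p ⊩ x ∧ 0#
  ⊩-∧0 p {x} = ⟂-mono ≤-refl (∨-least
    (≤-reflexive (trans (-‿cong (x∧0≈-[-x]⁺ x)) (solve 1 (λ n → ⊖ ⊖ n ⊜ n) ≡.refl ((- x) ⁺))))
    (0≤x⁺ (- x)))

  ⊩-⟂ : ∀ p {x} → 0# ≤ x → x ⟂ u → p ⊩ - x
  ⊩-⟂ p {x} 0≤x x⟂u = ⟂-mono (el≤u p)
    (∨-least (≤-reflexive (solve 1 (λ x → ⊖ ⊖ x ⊜ x) ≡.refl x)) 0≤x) (⟂-sym x⟂u)

  -- If `p` is not disjoint from `(- x) ⁺`, their meet is itself a condition, and it is disjoint
  -- from `x ⁺`, the negative part of `- x`.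
  decide : ∀ p x → p ⊩ x ⊎ (∃ λ q → q ⊑ p × q ⊩ - x)
  decide p x with em ℓ₂ {p ⊩ x}
  ... | yes p⊩x = inj₁ p⊩x
  ... | no p⊮x = inj₂ (q , x∧y≤x _ _ , ⟂-mono (x∧y≤y (el p) ((- x) ⁺)) ≤-refl (x⁺⟂[-x]⁺ (- x)))
    where
    q : Condition
    q = record
      { el      = el p ∧ (- x) ⁺
      ; nonneg  = ∧-greatest (nonneg p) (0≤x⁺ (- x))
      ; nonzero = p⊮x
      ; el≤u    = ≤-trans (x∧y≤x _ _) (el≤u p)
      }

  module _ (0≤u : 0# ≤ u) where

    -- If no extension worked, `p` would force `x - n · u` for every `n`. Then all `n · el p` would
    -- lie below `x ⁺`, against the Archimedean property.
    bound : ∀ p x → ∃ λ q → q ⊑ p × ∃ λ n → q ⊩ n · u - x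
    bound p x with em _ {∃ λ q → q ⊑ p × ∃ λ n → q ⊩ n · u - x}
    ... | yes found = found
    ... | no none = ⊥-elim (nonzero p (archimedean complete nx≤x⁺))
      where
      forced : ∀ n → p ⊩ x - n · u
      forced n with decide p (x - n · u)
      ... | inj₁ p⊩ = p⊩
      ... | inj₂ (q , q⊑p , q⊩) = ⊥-elim (none (q , q⊑p , n ,
              ⊩-mono q (≤-reflexive (solve 2 (λ x y → ⊖ (x ⊝ y) ⊜ y ⊝ x) ≡.refl x (n · u))) q⊩))
      nx≤x⁺ : ∀ n → n · el p ≤ x ⁺
      nx≤x⁺ n = y-x≤0⇒y≤x (⟂-dominated n (nonneg p) (forced n)
        (≤-shift₂ (·-mono-≤ n (el≤u p)) (x≤x⁺ x)
          (solve 4 (λ x y z w → ⊖ (x ⊝ y) ⊝ (z ⊝ w) ⊜ (y ⊝ z) ⊕ (w ⊝ x)) ≡.refl x (n · u) (n · el p) (x ⁺)))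
        (≤-shift (0≤x⁺ x) (solve 2 (λ z w → z ⊝ (z ⊝ w) ⊜ w ⊝ 𝟘) ≡.refl (n · el p) (x ⁺))))

    Located : Carrier → Condition → Set ℓ₂
    Located x p = Σ[ m ∈ ℤ ] p ⊩ x - m • u × p ⊩ ℤ.suc m • u - x

    -- Bounding both `x` and `- x` leaves a finite range of multiples of `u`, which `search` climbs
    -- one step at a time until a comparison fails.
    locate : ∀ x p → ∃ λ q → q ⊑ p × Located x q
    locate x p =
      let q , q⊑p , n , q⊩ = bound p x
          r , r⊑q , m , r⊩ = bound q (- x)
          s , s⊑r , located = search (m ℕ.+ n) (ℤ.- + m) r
            (⊩-mono r (≤-reflexive (trans (solve 2 (λ x y → y ⊝ ⊖ x ⊜ x ⊝ ⊖ y) ≡.refl x (m · u))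
                                          (+-congˡ (-‿cong (sym (•-homo-neg (+ m) u)))))) r⊩)
            (⊩-mono r (≤-reflexive (+-congʳ (•-congˡ (offset m n)))) (⊩-⊑ q r (n · u - x) r⊑q q⊩))
      in s , ≤-trans s⊑r (≤-trans r⊑q q⊑p) , located
      where
      offset : ∀ m n → + n ≡.≡ ℤ.- + m ℤ.+ + (m ℕ.+ n)
      offset m n = ≡.trans (≡.sym (ℤ.+-identityˡ (+ n)))
        (≡.trans (≡.cong (ℤ._+ + n) (≡.sym (ℤ.+-inverseˡ (+ m)))) (ℤ.+-assoc (ℤ.- + m) (+ m) (+ n)))
      search : ∀ k m p → p ⊩ x - m • u → p ⊩ (m ℤ.+ + k) • u - x → ∃ λ q → q ⊑ p × Located x q
      -- The range has shrunk to the single multiple `m • u`; the upper bound is relaxed by one `u`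
      -- to fit `Located`.
      search zero m p lower upper = p , ≤-refl , m , lower ,
        ⊩-mono p (+-monoˡ-≤ (- x)
          (≤-trans (≤-reflexive (•-congˡ (ℤ.+-identityʳ m)))
          (≤-trans (≤-trans (x≤x+y 0≤u) (≤-reflexive (solve 2 (λ z u → z ⊕ u ⊜ u ⊕ z) ≡.refl (m • u) u)))
                   (≤-reflexive (sym (trans (•-homo-+ 1ℤ m u) (+-congʳ (+-identityʳ u)))))))) upper
      search (suc k) m p lower upper with decide p (x - ℤ.suc m • u)
      ... | inj₁ p⊩ = search k (ℤ.suc m) p p⊩
              (⊩-mono p (≤-reflexive (+-congʳ (•-congˡ shift))) upper)
        where
        shift : m ℤ.+ + suc k ≡.≡ ℤ.suc m ℤ.+ + k
        shift = ≡.trans (≡.sym (ℤ.+-assoc m 1ℤ (+ k))) (≡.cong (ℤ._+ + k) (ℤ.+-comm m 1ℤ))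
      ... | inj₂ (q , q⊑p , q⊩) = q , q⊑p , m , ⊩-⊑ p q (x - m • u) q⊑p lower ,
              ⊩-mono q (≤-reflexive (solve 2 (λ x y → ⊖ (x ⊝ y) ⊜ y ⊝ x) ≡.refl x (ℤ.suc m • u))) q⊩

    -- If no extension worked, `p` would force `k · (v - s n)` above `u` for all `n`. Then `el p`
    -- would lie below all of these multiples, whose infimum is zero by `infimum-·`.
    approach : ∀ {s v} → IsSupremum _≤_ s v → ∀ k p →
               ∃ λ q → q ⊑ p × ∃ λ n → q ⊩ u - k · (v - s n)
    approach {s} {v} sup k p with em _ {∃ λ q → q ⊑ p × ∃ λ n → q ⊩ u - k · (v - s n)}
    ... | yes found = found
    ... | no none = ⊥-elim (nonzero p (infimum-· k (λ n → v - s n) (supremum-gap sup) below))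
      where
      forced : ∀ n → p ⊩ k · (v - s n) - u
      forced n with decide p (k · (v - s n) - u)
      ... | inj₁ p⊩ = p⊩
      ... | inj₂ (q , q⊑p , q⊩) = ⊥-elim (none (q , q⊑p , n ,
              ⊩-mono q (≤-reflexive (solve 2 (λ x y → ⊖ (x ⊝ y) ⊜ y ⊝ x) ≡.refl (k · (v - s n)) u)) q⊩))
      below : ∀ n → el p ≤ k · (v - s n)
      below n = y-x≤0⇒y≤x (⟂-dominated 1 (nonneg p) (forced n)
        (≤-shift (el≤u p) (solve 3 (λ a y u → ⊖ (y ⊝ u) ⊝ (a ⊝ y) ⊜ u ⊝ a) ≡.refl (el p) (k · (v - s n)) u))
        (≤-shift (·-nonneg k (x≤y⇒0≤y-x (proj₁ sup n)))
          (solve 2 (λ a y → (a ⊕ 𝟘) ⊝ (a ⊝ y) ⊜ y ⊝ 𝟘) ≡.refl (el p) (k · (v - s n)))))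

  module Generic {d} (D : ℕ → Condition → Set d) (dense : ∀ n p → ∃ λ q → q ⊑ p × D n q) (start : Condition) where

    generic : ℕ → Condition
    generic zero    = start
    generic (suc n) = proj₁ (dense n (generic n))

    generic-meets : ∀ n → D n (generic (suc n))
    generic-meets n = proj₂ (proj₂ (dense n (generic n)))

    generic-antitone : ∀ {m n} → m ℕ.≤′ n → generic n ⊑ generic m
    generic-antitone ℕ.≤′-refl          = ≤-refl
    generic-antitone (ℕ.≤′-step {n} m≤n) = ≤-trans (proj₁ (proj₂ (dense n (generic n)))) (generic-antitone m≤n)

    Positive : Carrier → Set ℓ₂
    Positive x = ∃ λ n → generic n ⊩ x

    Positive-mono : ∀ {x y} → x ≤ y → Positive x → Positive y
    Positive-mono x≤y (n , ⊩x) = n , ⊩-mono (generic n) x≤y ⊩x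

    Positive-nonneg : ∀ {x} → 0# ≤ x → Positive x
    Positive-nonneg 0≤x = 0 , ⊩-nonneg start 0≤x

    Positive-+ : ∀ {x y} → Positive x → Positive y → Positive (x + y)
    Positive-+ {x} {y} (m , ⊩x) (n , ⊩y) = m ℕ.⊔ n , ⊩-+ (generic (m ℕ.⊔ n))
      (⊩-⊑ (generic m) (generic (m ℕ.⊔ n)) x (generic-antitone (ℕ.≤⇒≤′ (ℕ.m≤m⊔n m n))) ⊩x)
      (⊩-⊑ (generic n) (generic (m ℕ.⊔ n)) y (generic-antitone (ℕ.≤⇒≤′ (ℕ.m≤n⊔m m n))) ⊩y)

    Positive-∧0 : ∀ {x} → Positive x → Positive (x ∧ 0#)
    Positive-∧0 (n , ⊩x) = n , ⊩-∧0 (generic n) ⊩x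

    Positive-⟂ : ∀ {x} → 0# ≤ x → x ⟂ u → Positive (- x)
    Positive-⟂ 0≤x x⟂u = 0 , ⊩-⟂ start 0≤x x⟂u

    -- A condition forcing `- u` would be disjoint from `u`, although it is nonzero and below `u`.
    ¬Positive-[-u] : ¬ Positive (- u)
    ¬Positive-[-u] (n , ⊩-u) = nonzero (generic n) (⟂-≤ ⊩-u
      (≤-trans (el≤u (generic n)) (≤-trans (≤-reflexive (solve 1 (λ u → u ⊜ ⊖ ⊖ u) ≡.refl u)) (x≤x⁺ (- - u)))))

-- Rational estimates and the order of the reals

module RationalArithmetic where

  open IntegerMultiples ℚ.+-0-abelianGroup
  open Solver public using (solve; _⊜_; _⊕_; _⊝_; ⊖_; 𝟘)

  <-shift : ∀ {p q r s} → p ℚ.< q → s ℚ.- r ≡ q ℚ.- p → r ℚ.< s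
  <-shift {p} {q} {r} {s} p<q eq = ≡.subst₂ ℚ._<_
    (solve 2 (λ p r → p ⊕ (r ⊝ p) ⊜ r) ≡.refl p r)
    (≡.trans (solve 3 (λ p q r → q ⊕ (r ⊝ p) ⊜ (q ⊝ p) ⊕ r) ≡.refl p q r)
    (≡.trans (≡.cong (ℚ._+ r) (≡.sym eq)) (solve 2 (λ r s → (s ⊝ r) ⊕ r ⊜ s) ≡.refl r s)))
    (ℚ.+-monoˡ-< (r ℚ.- p) p<q)

  ≤-shift : ∀ {p q r s} → p ℚ.≤ q → s ℚ.- r ≡ q ℚ.- p → r ℚ.≤ s
  ≤-shift {p} {q} {r} {s} p≤q eq = ≡.subst₂ ℚ._≤_
    (solve 2 (λ p r → p ⊕ (r ⊝ p) ⊜ r) ≡.refl p r)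
    (≡.trans (solve 3 (λ p q r → q ⊕ (r ⊝ p) ⊜ (q ⊝ p) ⊕ r) ≡.refl p q r)
    (≡.trans (≡.cong (ℚ._+ r) (≡.sym eq)) (solve 2 (λ r s → (s ⊝ r) ⊕ r ⊜ s) ≡.refl r s)))
    (ℚ.+-monoˡ-≤ (r ℚ.- p) p≤q)

  neg-involutive : ∀ p → ℚ.- (ℚ.- p) ≡ p
  neg-involutive = solve 1 (λ p → ⊖ ⊖ p ⊜ p) ≡.refl

  halve : ∀ {ε} → 0ℚ ℚ.< ε → ∃ λ δ → 0ℚ ℚ.< δ × δ ℚ.+ δ ≡ ε
  halve {ε} 0<ε = ℚ.½ ℚ.* ε
    , ℚ.positive⁻¹ (ℚ.½ ℚ.* ε) {{ℚ.pos*pos⇒pos ℚ.½ ε {{ℚ.positive 0<ε}}}}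
    , ≡.trans (≡.sym (ℚ.*-distribʳ-+ ε ℚ.½ ℚ.½)) (ℚ.*-identityˡ ε)

  1/[1+_] : ℕ → ℚ
  1/[1+ k ] = fromℚᵘ (mkℚᵘ 1ℤ k)

  small-reciprocal : ∀ {δ} → 0ℚ ℚ.< δ → ∃ λ k → 1/[1+ k ] ℚ.≤ δ
  small-reciprocal {mkℚ (+ zero) d c}   0<δ = ⊥-elim (ℚ.<-irrefl ≡.refl (ℚ.≤-<-trans (ℚ.*≤* (ℤ.+≤+ ℕ.z≤n)) 0<δ))
  small-reciprocal {mkℚ -[1+ n ] d c}   (ℚ.*<* ())
  -- `1/[1+ d ]` has the same denominator as `δ`, whose numerator is at least one.
  small-reciprocal {mkℚ +[1+ n ] d c}   0<δ = d , ℚ.toℚᵘ-cancel-≤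
    (ℚᵘ.≤-respˡ-≃ (ℚᵘ.≃-sym (ℚ.toℚᵘ-fromℚᵘ (mkℚᵘ 1ℤ d)))
      (*≤* (ℤ.*-monoʳ-≤-nonNeg (+ suc d) (ℤ.+≤+ (ℕ.s≤s {0} {n} ℕ.z≤n)))))

  -- Half of the gap is used for the reciprocal, which is bounded only weakly; the other half makes
  -- the inequality strict.
  reciprocal-<-gap : ∀ {q r} → q ℚ.< r → ∃ λ k → q ℚ.- r ℚ.< ℚ.- 1/[1+ k ]
  reciprocal-<-gap {q} {r} q<r =
    let ε , 0<ε , ε+ε≡r-q = halve (<-shift q<r (solve 2 (λ q r → (r ⊝ q) ⊝ 𝟘 ⊜ r ⊝ q) ≡.refl q r))
        k , 1/k≤ε = small-reciprocal 0<ε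
    in k , bound 1/[1+ k ] ε 1/k≤ε 0<ε ε+ε≡r-q
    where
    bound : ∀ t ε → t ℚ.≤ ε → 0ℚ ℚ.< ε → ε ℚ.+ ε ≡ r ℚ.- q → q ℚ.- r ℚ.< ℚ.- t
    bound t ε t≤ε 0<ε eq = <-shift (ℚ.+-mono-≤-< t≤ε 0<ε)
      (≡.trans (solve 3 (λ q r t → (⊖ t) ⊝ (q ⊝ r) ⊜ (r ⊝ q) ⊝ (t ⊕ 𝟘)) ≡.refl q r t)
               (≡.cong (ℚ._- (t ℚ.+ 0ℚ)) (≡.sym eq)))

  fromℚᵘ-suc : ∀ m k → fromℚᵘ (mkℚᵘ (ℤ.suc m) k) ≡ fromℚᵘ (mkℚᵘ m k) ℚ.+ 1/[1+ k ]
  fromℚᵘ-suc m k = ℚ.toℚᵘ-injective (ℚᵘ.≃-trans (ℚ.toℚᵘ-fromℚᵘ (mkℚᵘ (ℤ.suc m) k))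
    (ℚᵘ.≃-trans sum
    (ℚᵘ.≃-sym (ℚᵘ.≃-trans (ℚ.toℚᵘ-homo-+ (fromℚᵘ (mkℚᵘ m k)) 1/[1+ k ])
      (ℚᵘ.+-cong (ℚ.toℚᵘ-fromℚᵘ (mkℚᵘ m k)) (ℚ.toℚᵘ-fromℚᵘ (mkℚᵘ 1ℤ k)))))))
    where
    n = + suc k
    sum : mkℚᵘ (ℤ.suc m) k ℚᵘ.≃ mkℚᵘ m k ℚᵘ.+ mkℚᵘ 1ℤ k
    sum = *≡* (≡.trans (≡.sym (ℤ.*-assoc (ℤ.suc m) n n))
      (≡.cong (ℤ._* n) (≡.trans (≡.cong (ℤ._* n) (ℤ.+-comm 1ℤ m)) (ℤ.*-distribʳ-+ n m 1ℤ))))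

module RealOrder where

  open ℝ
  open RationalArithmetic

  -- Openness moves `p` up to some `p′`, and `y` is located within `p′ - p`. As the upper endpoint
  -- exceeds `p′`, the lower one exceeds `p`.
  separated⇒≤ : ∀ x y → (∀ {p q} → L x p → U y q → p ℚ.< q) → x ≤ℝ y
  separated⇒≤ x y sep {p} Lp =
    let p′ , p<p′ , Lp′ = L-open x Lp
        l , v , Ll , Uv , v≤ = located y (<-shift p<p′ (solve 2 (λ p q → (q ⊝ p) ⊝ 𝟘 ⊜ q ⊝ p) ≡.refl p p′))
        p<l = <-shift (ℚ.<-≤-trans (sep Lp′ Uv) v≤)
                (solve 3 (λ p q l → l ⊝ p ⊜ (l ⊕ (q ⊝ p)) ⊝ q) ≡.refl p p′ l)
    in L-lower y (ℚ.<⇒≤ p<l) Ll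

  -- The order compares lower cuts only, so upper cuts have to be recovered through locatedness.
  U-antitone : ∀ x y → x ≤ℝ y → ∀ {q} → U y q → U x q
  U-antitone x y x≤y {q} Uq =
    let q′ , q′<q , Uq′ = U-open y Uq
        l , v , Ll , Uv , v≤ = located x (<-shift q′<q (solve 2 (λ p q → (q ⊝ p) ⊝ 𝟘 ⊜ q ⊝ p) ≡.refl q′ q))
        v<q = ℚ.≤-<-trans v≤ (<-shift (separated y (x≤y Ll) Uq′)
                (solve 3 (λ q q′ l → q ⊝ (l ⊕ (q ⊝ q′)) ⊜ q′ ⊝ l) ≡.refl q q′ l))
    in U-upper x (ℚ.<⇒≤ v<q) Uv

-- Real numbers from a positive cone

module Cuts {c ℓ₁ ℓ₂} (G : AbelianℓGroup c ℓ₁ ℓ₂) (u : AbelianℓGroup.Carrier G) where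

  open AbelianℓGroup G
  open ℓGroupProperties G
  open ℝ

  private
    module ℚS = RationalArithmetic

  -- `P-∧0` gives compatibility with the lattice operations, and `¬P-[-u]` lets `u` take the value
  -- `1`. Totality is obtained element by element, in `located⇒total`.
  record IsPositiveCone (P : Pred Carrier 0ℓ) : Set (c ⊔ ℓ₂) where
    field
      P-mono    : ∀ {x y} → x ≤ y → P x → P y
      P-nonneg  : ∀ {x} → 0# ≤ x → P x
      P-+       : ∀ {x y} → P x → P y → P (x + y)
      P-∧0      : ∀ {x} → P x → P (x ∧ 0#)
      0≤u       : 0# ≤ u
      ¬P-[-u]   : ¬ P (- u)

  module _ {P : Pred Carrier 0ℓ} (isPositiveCone : IsPositiveCone P) where

    open IsPositiveCone isPositiveCone

    P-cong : ∀ {x y} → x ≈ y → P x → P y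
    P-cong x≈y = P-mono (≤-reflexive x≈y)

    P-· : ∀ n {x} → P x → P (n · x)
    P-· zero    Px = P-nonneg ≤-refl
    P-· (suc n) Px = P-+ Px (P-· n Px)

    P-•⇒nonneg : ∀ z → P (z • u) → 0ℤ ℤ.≤ z
    P-•⇒nonneg (+ n)    _ = ℤ.+≤+ ℕ.z≤n
    P-•⇒nonneg -[1+ n ] P-nu = ⊥-elim (¬P-[-u] (P-mono (neg-antimono-≤ (x≤x+y (·-nonneg n 0≤u))) P-nu))

    •-nonneg : ∀ {z} → 0ℤ ℤ.≤ z → 0# ≤ z • u
    •-nonneg {+ n} _ = ·-nonneg n 0≤u

    -- The real number represented by x exceeds r; asking for p > r keeps the lower cut open.
    Above : Carrier → ℚ → Set
    Above x r = ∃ λ p → toℚᵘ r ℚᵘ.< p × P (↧ₙ p · x - ↥ p • u)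

    Above-≤ : ∀ {x q r} → q ℚ.≤ r → Above x r → Above x q
    Above-≤ q≤r (p , r<p , Px) = p , ℚᵘ.≤-<-trans (ℚ.toℚᵘ-mono-≤ q≤r) r<p , Px

    Above-open : ∀ {x r} → Above x r → ∃ λ q → r ℚ.< q × Above x q
    Above-open {r = r} (p , r<p , Px) =
      let q , r<q , q<p = ℚ.<-dense (ℚ.toℚᵘ-cancel-< {r} {fromℚᵘ p} (ℚᵘ.<-respʳ-≃ (ℚᵘ.≃-sym (ℚ.toℚᵘ-fromℚᵘ p)) r<p))
      in q , r<q , p , ℚᵘ.<-respʳ-≃ (ℚ.toℚᵘ-fromℚᵘ p) (ℚ.toℚᵘ-mono-< q<p) , Px

    Above-P : ∀ {x y r} → P (y - x) → Above x r → Above y r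
    Above-P {x} {y} P[y-x] (p , r<p , Px) = p , r<p , P-cong
      (trans (+-congˡ (·-homo-- n y x))
        (solve 3 (λ a b z → (a ⊝ z) ⊕ (b ⊝ a) ⊜ b ⊝ z) ≡.refl (n · x) (n · y) (↥ p • u)))
      (P-+ Px (P-· n P[y-x]))
      where n = ↧ₙ p

    Above-mono : ∀ {x y r} → x ≤ y → Above x r → Above y r
    Above-mono x≤y = Above-P (P-nonneg (x≤y⇒0≤y-x x≤y))

    -- The two cone elements are brought to a common denominator. The witnesses are unnormalised, so
    -- their sum has literally the numerator and the denominator that `combine` produces.
    Above-+ : ∀ {x y q r} → Above x q → Above y r → Above (x + y) (q ℚ.+ r)
    Above-+ {x} {y} {q} {r} (p@(mkℚᵘ _ _) , q<p , Px) (p′@(mkℚᵘ _ _) , r<p′ , Py) = p ℚᵘ.+ p′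
      , ℚᵘ.<-respˡ-≃ (ℚᵘ.≃-sym (ℚ.toℚᵘ-homo-+ q r)) (ℚᵘ.+-mono-< q<p r<p′)
      , P-cong combine (P-+ (P-· m Px) (P-· n Py))
      where
      n = ↧ₙ p
      m = ↧ₙ p′
      a = ↥ p
      b = ↥ p′
      scale : ∀ k l z w → k · (l · w - z • u) ≈ (k ℕ.* l) · w - (z ℤ.* + k) • u
      scale k l z w = trans (·-homo-- k (l · w) (z • u))
        (+-cong (·-assocˡ w k l) (-‿cong (trans (sym (•-homo-* k z u)) (•-congˡ (ℤ.*-comm (+ k) z)))))
      combine : m · (n · x - a • u) + n · (m · y - b • u) ≈
                (n ℕ.* m) · (x + y) - (a ℤ.* + m ℤ.+ b ℤ.* + n) • u
      combine = trans (+-cong (scale m n a x) (scale n m b y))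
        (trans (+-congʳ (+-congʳ (reflexive (≡.cong (_· x) (ℕ.*-comm m n)))))
        (trans (solve 4 (λ x y a b → (x ⊝ a) ⊕ (y ⊝ b) ⊜ (x ⊕ y) ⊝ (a ⊕ b)) ≡.refl
                  ((n ℕ.* m) · x) ((n ℕ.* m) · y) ((a ℤ.* + m) • u) ((b ℤ.* + n) • u))
        (+-cong (sym (·-distrib-+ x y (n ℕ.* m))) (-‿cong (sym (•-homo-+ (a ℤ.* + m) (b ℤ.* + n) u))))))

    Above-u⇒<1 : ∀ {r} → Above u r → r ℚ.< 1ℚ
    Above-u⇒<1 {r} (p , r<p , Pu) = ℚ.toℚᵘ-cancel-< (ℚᵘ.<-≤-trans r<p
      (*≤* (≡.subst₂ ℤ._≤_ (≡.sym (ℤ.*-identityʳ (↥ p))) (≡.sym (ℤ.*-identityˡ (↧ p)))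
        (ℤ.0≤i-j⇒j≤i (P-•⇒nonneg (↧ p ℤ.- ↥ p)
          (P-cong (sym (trans (•-homo-+ (↧ p) (ℤ.- ↥ p) u) (+-congˡ (•-homo-neg (↥ p) u)))) Pu))))))

    <1⇒Above-u : ∀ {r} → r ℚ.< 1ℚ → Above u r
    <1⇒Above-u {r} r<1 = 1ℚᵘ , ℚ.toℚᵘ-mono-< r<1 , P-nonneg (≤-reflexive (sym (+-inverseʳ (1 · u))))

    Above-0⇒<0 : ∀ {r} → Above 0# r → r ℚ.< 0ℚ
    Above-0⇒<0 {r} (p , r<p , P0) = ℚ.toℚᵘ-cancel-< (ℚᵘ.<-≤-trans r<p
      (*≤* (≡.subst₂ ℤ._≤_ (≡.sym (ℤ.*-identityʳ (↥ p))) (≡.sym (ℤ.*-zeroˡ (↧ p)))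
        (ℤ.neg-cancel-≤ (P-•⇒nonneg (ℤ.- ↥ p)
          (P-cong (trans (+-congʳ (·-zeroʳ (↧ₙ p))) (trans (+-identityˡ _) (sym (•-homo-neg (↥ p) u)))) P0))))))

    <0⇒Above-0 : ∀ {r} → r ℚ.< 0ℚ → Above 0# r
    <0⇒Above-0 {r} r<0 = 0ℚᵘ , ℚ.toℚᵘ-mono-< r<0 ,
      P-nonneg (≤-reflexive (solve 0 (𝟘 ⊜ (𝟘 ⊕ 𝟘) ⊝ 𝟘) ≡.refl))

    Above-separated : ∀ {x q r} → Above x q → Above (- x) (ℚ.- r) → q ℚ.< r
    Above-separated {x} {q} {r} x>q -x>-r =
      ℚS.<-shift (Above-0⇒<0 (Above-mono (≤-reflexive (+-inverseʳ x)) (Above-+ x>q -x>-r)))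
        (ℚS.solve 2 (λ q r → r ℚS.⊝ q ℚS.⊜ ℚS.𝟘 ℚS.⊝ (q ℚS.⊝ r)) ≡.refl q r)

    -- The clause for `k` determines the value of `x` up to `1 / (1 + k)`.
    IsLocated : Carrier → Set
    IsLocated x = ∀ k → Σ[ m ∈ ℤ ] P (suc k · x - m • u) × P (ℤ.suc m • u - suc k · x)

    -- At `k = 0` the element lies between consecutive multiples of `u`; zero is never strictly
    -- between these, so the sign of `m` decides.
    located⇒total : ∀ {x} → IsLocated x → P x ⊎ P (- x)
    located⇒total {x} loc with loc 0
    ... | + n , lower , _ = inj₁ (P-mono
            (≤-shift (·-nonneg n 0≤u) (solve 2 (λ x z → x ⊝ ((x ⊕ 𝟘) ⊝ z) ⊜ z ⊝ 𝟘) ≡.refl x (n · u))) lower)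
    ... | -[1+ n ] , _ , upper = inj₂ (P-mono
            (≤-shift (•-nonneg (ℤ.neg-mono-≤ (suc-nonpos n)))
              (trans (solve 2 (λ x z → ⊖ x ⊝ (z ⊝ (x ⊕ 𝟘)) ⊜ ⊖ z ⊝ 𝟘) ≡.refl x (ℤ.suc -[1+ n ] • u))
                     (+-congʳ (sym (•-homo-neg (ℤ.suc -[1+ n ]) u))))) upper)
      where
      suc-nonpos : ∀ n → ℤ.suc -[1+ n ] ℤ.≤ 0ℤ
      suc-nonpos zero    = ℤ.≤-refl
      suc-nonpos (suc n) = ℤ.-≤+

    cut : ∀ {x} → IsLocated x → ℝ
    cut {x} loc .L r = Above x r
    cut {x} loc .U r = Above (- x) (ℚ.- r)
    cut {x} loc .L-lower q≤r = Above-≤ q≤r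
    cut {x} loc .U-upper q≤r = Above-≤ (ℚ.neg-antimono-≤ q≤r)
    cut {x} loc .L-open = Above-open
    cut {x} loc .U-open {q} above =
      let q′ , -q<q′ , above′ = Above-open above in
      ℚ.- q′ , ≡.subst (ℚ.- q′ ℚ.<_) (ℚS.neg-involutive q) (ℚ.neg-antimono-< -q<q′)
             , ≡.subst (Above (- x)) (≡.sym (ℚS.neg-involutive q′)) above′
    cut {x} loc .separated = Above-separated
    cut {x} loc .located {ε} 0<ε =
      -- `ε` is four times `η`: one `η` goes to each of the margins that make the bounds strict, one
      -- covers the distance of `s` and `t`, and one is spare.
      let δ , 0<δ , δ+δ≡ε = ℚS.halve 0<ε
          η , 0<η , η+η≡δ = ℚS.halve 0<δ
          k , 1/k≤η = ℚS.small-reciprocal 0<η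
          m , lower , upper = loc k
          s = fromℚᵘ (mkℚᵘ m k)
          t = fromℚᵘ (mkℚᵘ (ℤ.suc m) k)
          q = ℚS.1/[1+ k ]
      in s ℚ.- η , t ℚ.+ η
       , (mkℚᵘ m k , below-fromℚᵘ (mkℚᵘ m k) (ℚS.<-shift 0<η
            (ℚS.solve 2 (λ s e → s ℚS.⊝ (s ℚS.⊝ e) ℚS.⊜ e ℚS.⊝ ℚS.𝟘) ≡.refl s η)) , lower)
       , (ℚᵘ.- mkℚᵘ (ℤ.suc m) k
         , ℚᵘ.<-respʳ-≃ (ℚᵘ.-‿cong (ℚ.toℚᵘ-fromℚᵘ (mkℚᵘ (ℤ.suc m) k)))
             (ℚᵘ.<-respˡ-≃ (ℚᵘ.≃-sym (ℚ.toℚᵘ-homo‿- (t ℚ.+ η))) (ℚᵘ.neg-mono-< (ℚ.toℚᵘ-mono-< (ℚS.<-shift 0<η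
               (ℚS.solve 2 (λ t e → (t ℚS.⊕ e) ℚS.⊝ t ℚS.⊜ e ℚS.⊝ ℚS.𝟘) ≡.refl t η)))))
         , P-cong (sym (negated k (ℤ.suc m))) upper)
       , ℚS.≤-shift (ℚ.+-mono-≤ 1/k≤η (ℚ.<⇒≤ 0<η))
           (≡.trans (≡.cong₂ (λ a b → (s ℚ.- η) ℚ.+ a ℚ.- (b ℚ.+ η))
                       (≡.trans (≡.sym δ+δ≡ε) (≡.cong (λ d → d ℚ.+ d) (≡.sym η+η≡δ))) (ℚS.fromℚᵘ-suc m k))
             (ℚS.solve 3 (λ s e q → ((s ℚS.⊝ e) ℚS.⊕ ((e ℚS.⊕ e) ℚS.⊕ (e ℚS.⊕ e))) ℚS.⊝ ((s ℚS.⊕ q) ℚS.⊕ e)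
                                  ℚS.⊜ (e ℚS.⊕ e) ℚS.⊝ (q ℚS.⊕ ℚS.𝟘)) ≡.refl s η q))
      where
      below-fromℚᵘ : ∀ p {r} → r ℚ.< fromℚᵘ p → toℚᵘ r ℚᵘ.< p
      below-fromℚᵘ p r<p = ℚᵘ.<-respʳ-≃ (ℚ.toℚᵘ-fromℚᵘ p) (ℚ.toℚᵘ-mono-< r<p)
      negated : ∀ k m → suc k · - x - (ℤ.- m) • u ≈ m • u - suc k · x
      negated k m = trans (+-cong (·-homo-neg (suc k) x) (-‿cong (•-homo-neg m u)))
        (solve 2 (λ x z → ⊖ x ⊝ ⊖ z ⊜ z ⊝ x) ≡.refl (suc k · x) (m • u))

    record Represents (ξ : ℝ) (x : Carrier) : Set where
      field
        L⇒Above : ∀ {r} → L ξ r → Above x r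
        Above⇒L : ∀ {r} → Above x r → L ξ r
        U⇒Above : ∀ {r} → U ξ r → Above (- x) (ℚ.- r)
        Above⇒U : ∀ {r} → Above (- x) (ℚ.- r) → U ξ r

    open Represents

    ≃cut⇒represents : ∀ {ξ x} (loc : IsLocated x) → ξ ≃ℝ cut loc → Represents ξ x
    ≃cut⇒represents {ξ} loc (ξ≤ , ≤ξ) = record
      { L⇒Above = ξ≤
      ; Above⇒L = ≤ξ
      ; U⇒Above = RealOrder.U-antitone (cut loc) ξ ≤ξ
      ; Above⇒U = RealOrder.U-antitone ξ (cut loc) ξ≤
      }

    represents-mono : ∀ {ξ η x y} → Represents ξ x → Represents η y → P (y - x) → ξ ≤ℝ η
    represents-mono rx ry P[y-x] Lξ = Above⇒L ry (Above-P P[y-x] (L⇒Above rx Lξ))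

    represents-≤ : ∀ {ξ η x y} → Represents ξ x → Represents η y → x ≤ y → ξ ≤ℝ η
    represents-≤ rx ry x≤y = represents-mono rx ry (P-nonneg (x≤y⇒0≤y-x x≤y))

    represents-0 : ∀ {ξ} → Represents ξ 0# → ξ ≃ℝ 0ℝ
    represents-0 r0 = (λ Lξ → Above-0⇒<0 (L⇒Above r0 Lξ)) , (λ r<0 → Above⇒L r0 (<0⇒Above-0 r<0))

    represents-neg : ∀ {ξ η x} → Represents ξ x → Represents η (- x) → η ≃ℝ -ℝ ξ
    represents-neg {x = x} rx r-x =
        (λ {p} Lη → Above⇒U rx (≡.subst (Above (- x)) (≡.sym (ℚS.neg-involutive p)) (L⇒Above r-x Lη)))
      , (λ {p} Uξ → Above⇒L r-x (≡.subst (Above (- x)) (ℚS.neg-involutive p) (U⇒Above rx Uξ)))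

    -- Splitting a rational below the sum is avoided: by `separated⇒≤` it suffices to compare lower
    -- bounds of one side with upper bounds of the other, where `Above-+` applies.
    represents-+ : ∀ {ξ η ζ x y} → Represents ξ x → Represents η y → Represents ζ (x + y) → ζ ≃ℝ ξ +ℝ η
    represents-+ {ξ} {η} {ζ} {x} {y} rx ry rz =
        RealOrder.separated⇒≤ ζ (ξ +ℝ η)
          (λ { {p} Lζ (q , r , Uξ , Uη , ≡.refl) → Above-separated {x + y} (L⇒Above rz Lζ)
            (≡.subst (Above (- (x + y))) (ℚS.solve 2 (λ q r → (ℚS.⊖ q) ℚS.⊕ (ℚS.⊖ r) ℚS.⊜ ℚS.⊖ (q ℚS.⊕ r)) ≡.refl q r)
              (Above-mono (≤-reflexive (solve 2 (λ x y → ⊖ x ⊕ ⊖ y ⊜ ⊖ (x ⊕ y)) ≡.refl x y))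
                (Above-+ (U⇒Above rx Uξ) (U⇒Above ry Uη)))) })
      , RealOrder.separated⇒≤ (ξ +ℝ η) ζ
          (λ { (q , r , Lξ , Lη , ≡.refl) Uζ →
            Above-separated {x + y} (Above-+ (L⇒Above rx Lξ) (L⇒Above ry Lη)) (U⇒Above rz Uζ) })

    -- `x - (x ∨ y)` dominates `(x - y) ∧ 0#`, which `P-∧0` puts into the cone.
    P-∨ : ∀ {x y} → P (x - y) → P (x - (x ∨ y))
    P-∨ {x} {y} P[x-y] = P-mono
      (≤-shift {w = x ∨ y} {x = x - ((x - y) ∧ 0#)}
        (∨-least
          (≤-shift (x∧y≤y (x - y) 0#) (solve 2 (λ x z → (x ⊝ z) ⊝ x ⊜ 𝟘 ⊝ z) ≡.refl x ((x - y) ∧ 0#)))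
          (≤-shift (x∧y≤x (x - y) 0#)
            (solve 3 (λ x y z → (x ⊝ z) ⊝ y ⊜ (x ⊝ y) ⊝ z) ≡.refl x y ((x - y) ∧ 0#))))
        (solve 3 (λ x j z → (x ⊝ j) ⊝ z ⊜ (x ⊝ z) ⊝ j) ≡.refl x (x ∨ y) ((x - y) ∧ 0#)))
      (P-∧0 P[x-y])

    P-∧ : ∀ {x y} → P (x - y) → P ((x ∧ y) - y)
    P-∧ {x} {y} P[x-y] = P-mono
      (≤-shift {w = ((x - y) ∧ 0#) + y} {x = x ∧ y}
        (∧-greatest
          (≤-shift (x∧y≤x (x - y) 0#)
            (solve 3 (λ x y z → x ⊝ (z ⊕ y) ⊜ (x ⊝ y) ⊝ z) ≡.refl x y ((x - y) ∧ 0#)))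
          (≤-shift (x∧y≤y (x - y) 0#) (solve 2 (λ y z → y ⊝ (z ⊕ y) ⊜ 𝟘 ⊝ z) ≡.refl y ((x - y) ∧ 0#))))
        (solve 3 (λ m y z → (m ⊝ y) ⊝ z ⊜ m ⊝ (z ⊕ y)) ≡.refl (x ∧ y) y ((x - y) ∧ 0#)))
      (P-∧0 P[x-y])

    private
      P-total : ∀ {x y} → IsLocated (x - y) → P (x - y) ⊎ P (y - x)
      P-total {x} {y} loc with located⇒total loc
      ... | inj₁ P[x-y] = inj₁ P[x-y]
      ... | inj₂ P-[x-y] = inj₂ (P-cong (solve 2 (λ x y → ⊖ (x ⊝ y) ⊜ y ⊝ x) ≡.refl x y) P-[x-y])

    -- Locatedness of `x - y` decides which argument the join equals modulo the cone.
    represents-∨ : ∀ {ξ η ζ x y} → Represents ξ x → Represents η y → Represents ζ (x ∨ y) →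
                   IsLocated (x - y) → ζ ≃ℝ ξ ∨ℝ η
    represents-∨ {ξ} {η} {ζ} {x} {y} rx ry rz loc = ζ≤ξ∨η (P-total loc) ,
        λ { (inj₁ Lξ) → represents-≤ rx rz (x≤x∨y x y) Lξ ; (inj₂ Lη) → represents-≤ ry rz (y≤x∨y x y) Lη }
      where
      ζ≤ξ∨η : P (x - y) ⊎ P (y - x) → ζ ≤ℝ ξ ∨ℝ η
      ζ≤ξ∨η (inj₁ P[x-y]) Lζ = inj₁ (represents-mono rz rx (P-∨ P[x-y]) Lζ)
      ζ≤ξ∨η (inj₂ P[y-x]) Lζ = inj₂ (represents-mono rz ry
        (P-mono (+-mono-≤ ≤-refl (neg-antimono-≤ (∨-least (y≤x∨y y x) (x≤x∨y y x)))) (P-∨ P[y-x])) Lζ)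

    represents-∧ : ∀ {ξ η ζ x y} → Represents ξ x → Represents η y → Represents ζ (x ∧ y) →
                   IsLocated (x - y) → ζ ≃ℝ ξ ∧ℝ η
    represents-∧ {ξ} {η} {ζ} {x} {y} rx ry rz loc =
        (λ Lζ → represents-≤ rz rx (x∧y≤x x y) Lζ , represents-≤ rz ry (x∧y≤y x y) Lζ) , ξ∧η≤ζ (P-total loc)
      where
      ξ∧η≤ζ : P (x - y) ⊎ P (y - x) → ξ ∧ℝ η ≤ℝ ζ
      ξ∧η≤ζ (inj₁ P[x-y]) (_ , Lη) = represents-mono ry rz (P-∧ P[x-y]) Lη
      ξ∧η≤ζ (inj₂ P[y-x]) (Lξ , _) = represents-mono rx rz
        (P-mono (+-monoˡ-≤ (- x) (∧-greatest (x∧y≤y y x) (x∧y≤x y x))) (P-∧ P[y-x])) Lξ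

    represents-∧1 : ∀ {ξ ζ x t} → Represents ξ x → Represents ζ t → IsLocated (x - u) →
                    P (t - (x ∧ u)) → P ((x ∧ u) - t) → ζ ≃ℝ ξ ∧ℝ 1ℝ
    represents-∧1 {ξ} {ζ} {x} {t} rx rt loc P[t-x∧u] P[x∧u-t] =
        (λ Lζ → let above = Above-P P[x∧u-t] (L⇒Above rt Lζ) in
          Above⇒L rx (Above-mono (x∧y≤x x u) above) , Above-u⇒<1 (Above-mono (x∧y≤y x u) above))
      , λ Lξ∧1 → Above⇒L rt (Above-P P[t-x∧u] (above-x∧u (P-total loc) Lξ∧1))
      where
      above-x∧u : P (x - u) ⊎ P (u - x) → ∀ {r} → L (ξ ∧ℝ 1ℝ) r → Above (x ∧ u) r
      above-x∧u (inj₁ P[x-u]) (_ , r<1) = Above-P (P-∧ P[x-u]) (<1⇒Above-u r<1)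
      above-x∧u (inj₂ P[u-x]) (Lξ , _) = Above-P
        (P-mono (+-monoˡ-≤ (- x) (∧-greatest (x∧y≤y u x) (x∧y≤x u x))) (P-∧ P[u-x])) (L⇒Above rx Lξ)

    Above-approach : ∀ {x y q r} k → P (u - suc k · (y - x)) → Above y r →
                     q ℚ.- r ℚ.< ℚ.- ℚS.1/[1+ k ] → Above x q
    Above-approach {x} {y} {q} {r} k near y>r q-r<-1/k =
      ≡.subst (Above x) (ℚS.solve 2 (λ q r → (q ℚS.⊝ r) ℚS.⊕ r ℚS.⊜ q) ≡.refl q r)
        (Above-mono (≤-reflexive (solve 2 (λ x y → (x ⊝ y) ⊕ y ⊜ x) ≡.refl x y)) (Above-+ x-y>q-r y>r))
      where
      x-y>q-r : Above (x - y) (q ℚ.- r)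
      -- The witness is `- 1 / (1 + k)`, which `near` places below the value of `x - y`.
      x-y>q-r = mkℚᵘ -[1+ 0 ] k
        , ℚᵘ.<-respʳ-≃ (ℚᵘ.≃-trans (ℚ.toℚᵘ-homo‿- ℚS.1/[1+ k ]) (ℚᵘ.-‿cong (ℚ.toℚᵘ-fromℚᵘ (mkℚᵘ 1ℤ k))))
            (ℚ.toℚᵘ-mono-< q-r<-1/k)
        , P-cong (trans (+-congˡ (trans (-‿cong (·-congʳ (suc k) (solve 2 (λ x y → y ⊝ x ⊜ ⊖ (x ⊝ y)) ≡.refl x y)))
                                        (-‿cong (·-homo-neg (suc k) (x - y)))))
                   (solve 2 (λ u z → u ⊝ ⊖ z ⊜ z ⊝ ⊖ (u ⊕ 𝟘)) ≡.refl u (suc k · (x - y)))) near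

    -- Openness of the lower cut yields some `r′ > r` below the value of `v`; some `s n` comes
    -- closer to `v` than the gap between `r` and `r′`.
    represents-sup : ∀ {ξ v} {σ : ℕ → ℝ} {s : ℕ → Carrier} → Represents ξ v → (∀ n → Represents (σ n) (s n)) →
                     (∀ k → ∃ λ n → P (u - k · (v - s n))) → ∀ {r} → L ξ r → ∃ λ n → L (σ n) r
    represents-sup {v = v} {σ} rv rs approach {r} Lξ = from-above (Above-open (L⇒Above rv Lξ))
      where
      from-gap : ∀ {r′} → Above v r′ → (∃ λ k → r ℚ.- r′ ℚ.< ℚ.- ℚS.1/[1+ k ]) → ∃ λ n → L (σ n) r
      from-gap v>r′ (k , gap) =
        let n , near = approach (suc k) in n , Above⇒L (rs n) (Above-approach k near v>r′ gap)
      from-above : (∃ λ r′ → r ℚ.< r′ × Above v r′) → ∃ λ n → L (σ n) r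
      from-above (_ , r<r′ , v>r′) = from-gap v>r′ (ℚS.reciprocal-<-gap r<r′)

    -- The hypothesis makes `x` exceed `y` by at least `1 / n`. With `η` located to a smaller `ε`,
    -- the point `p + ε` is in the lower cut of `ξ`; were it in that of `η`, it would be below
    -- `q ≤ p + ε`.
    represents-≰ : ∀ {ξ η x y} → Represents ξ x → Represents η y → ∀ n → P (n · (x - y) - u) → ¬ (ξ ≤ℝ η)
    represents-≰ rx ry zero    P-u ξ≤η = ¬P-[-u] (P-cong (+-identityˡ _) P-u)
    represents-≰ {ξ} {η} {x} {y} rx ry (suc n) P[n[x-y]-u] ξ≤η =
      let ε , 0<ε , ε<1/n = ℚ.<-dense {0ℚ} {ℚS.1/[1+ n ]} (ℚ.toℚᵘ-cancel-< (ℚᵘ.<-respʳ-≃ (ℚᵘ.≃-sym (ℚ.toℚᵘ-fromℚᵘ (mkℚᵘ 1ℤ n)))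
                (*<* (ℤ.+<+ (ℕ.s≤s ℕ.z≤n)))))
          p , q , Lη , Uη , q≤p+ε = located η 0<ε
          x-y>ε : Above (x - y) ε
          x-y>ε = mkℚᵘ 1ℤ n , ℚᵘ.<-respʳ-≃ (ℚ.toℚᵘ-fromℚᵘ (mkℚᵘ 1ℤ n)) (ℚ.toℚᵘ-mono-< ε<1/n)
                , P-cong (+-congˡ (-‿cong (sym (+-identityʳ u)))) P[n[x-y]-u]
          x>p+ε = Above-mono (≤-reflexive (solve 2 (λ x y → y ⊕ (x ⊝ y) ⊜ x) ≡.refl x y)) (Above-+ (L⇒Above ry Lη) x-y>ε)
      in ℚ.<-irrefl ≡.refl (ℚ.<-≤-trans (separated η (ξ≤η (Above⇒L rx x>p+ε)) Uη) q≤p+ε)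

-- Coding reals in the lowest universe

module Codes (em : ∀ ℓ → ExcludedMiddle ℓ) where

  open ℝ

  -- ℝ lives in Set₁, so points of X are built from Boolean lower cuts instead.
  LowerCut : Set
  LowerCut = ℚ → Bool

  IsCodeOf : LowerCut → ℝ → Set
  IsCodeOf b ξ = ∀ r → (L ξ r → T (b r)) × (T (b r) → L ξ r)

  decode : LowerCut → ℝ
  decode b with em (lsuc 0ℓ) {∃ (IsCodeOf b)}
  ... | yes (ξ , _) = ξ
  -- A default for functions that code no real, so that every point has values everywhere.
  ... | no _        = 0ℝ

  decode-≃ : ∀ {b ξ} → IsCodeOf b ξ → decode b ≃ℝ ξ
  decode-≃ {b} {ξ} code with em (lsuc 0ℓ) {∃ (IsCodeOf b)}
  ... | yes (η , codeη) = (λ {r} Lη → proj₂ (code r) (proj₁ (codeη r) Lη)) , (λ {r} Lξ → proj₂ (codeη r) (proj₁ (code r) Lξ))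
  ... | no none         = ⊥-elim (none (ξ , code))

-- Relations and the generic points that satisfy countably many of them

module Points
  (em : ∀ ℓ → ExcludedMiddle ℓ) {c ℓ₁ ℓ₂} (G : TruncatedℓGroup c ℓ₁ ℓ₂)
  (complete : DedekindσComplete (TruncatedℓGroup._≤_ G))
  where

  open TruncatedℓGroup G
  open ℓGroupProperties ℓGroup
  open TruncationUnits em G complete
  open Codes em
  open ℝ

  -- Bundling instances of all operations gives one generating family for the σ-ideal; an instance
  -- of a single kind is padded with trivial data.
  record Relation : Set (c ⊔ ℓ₁ ⊔ ℓ₂) where
    field
      f g   : Carrier
      s     : ℕ → Carrier
      v     : Carrier
      isSup : IsSupremum _≤_ s v

  record Satisfied (φ : Carrier → ℝ) (R : Relation) : Set where
    open Relation R
    field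
      +-homo     : φ (f + g) ≃ℝ φ f +ℝ φ g
      neg-homo   : φ (- f) ≃ℝ -ℝ φ f
      0-homo     : φ 0# ≃ℝ 0ℝ
      ∨-homo     : φ (f ∨ g) ≃ℝ φ f ∨ℝ φ g
      ∧-homo     : φ (f ∧ g) ≃ℝ φ f ∧ℝ φ g
      trunc-homo : φ (trunc f) ≃ℝ φ f ∧ℝ 1ℝ
      sup-upper  : ∀ n → φ (s n) ≤ℝ φ v
      sup-least  : ∀ {r} → L (φ v) r → ∃ λ n → L (φ (s n)) r

  -- f - g and f - u are listed because their signs decide the meets and joins.
  elements : Carrier → Relation → ℕ → Carrier
  elements u R = elem
    where
    open Relation R
    elem : ℕ → Carrier
    elem 0  = f
    elem 1  = g
    elem 2  = f + g
    elem 3  = - f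
    elem 4  = f ∨ g
    elem 5  = f ∧ g
    elem 6  = trunc f
    elem 7  = 0#
    elem 8  = f - g
    elem 9  = f - u
    elem 10 = v
    elem (suc (suc (suc (suc (suc (suc (suc (suc (suc (suc (suc n))))))))))) = s n

  Point : Set c
  Point = Carrier → LowerCut

  evaluate : Point → Carrier → ℝ
  evaluate x f = decode (x f)

  module GenericPoint
    (R : ℕ → Relation) {u} (isUnit : IsTruncationUnit u) (u≰0 : ¬ (u ≤ 0#))
    where

    open IsTruncationUnit isUnit
    open Forcing em ℓGroup complete u
    open Cuts ℓGroup u
    open Relation

    Requirement : ℕ → ℕ × ℕ → Condition → Set ℓ₂
    Requirement a (i , k) p = Located 0≤u (suc k · elements u (R a) i) p
      × ∃ λ n → p ⊩ u - k · (v (R a) - s (R a) n)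

    requirement : ℕ × ℕ → Condition → Set ℓ₂
    requirement (a , b) = Requirement a (unpair b)

    dense : ∀ j p → ∃ λ q → q ⊑ p × requirement (unpair j) q
    dense j p =
      let a , b = unpair j
          i , k = unpair b
          q , q⊑p , m , lower , upper = locate 0≤u (suc k · elements u (R a) i) p
          r , r⊑q , n , near = approach 0≤u (isSup (R a)) k q
      in r , ≤-trans r⊑q q⊑p , (m , ⊩-⊑ q r _ r⊑q lower , ⊩-⊑ q r _ r⊑q upper) , n , near

    start : Condition
    start = record { el = u ; nonneg = 0≤u ; nonzero = u≰0 ; el≤u = ≤-refl }

    open Generic (λ j → requirement (unpair j)) dense start

    met : ∀ a i k → ∃ λ n → Requirement a (i , k) (generic n)
    met a i k =
      let b , eqb = unpair-surjective i k
          j , eqj = unpair-surjective a b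
      in suc j , ≡.subst (λ ik → Requirement a ik (generic (suc j))) eqb
                   (≡.subst (λ ab → requirement ab (generic (suc j))) eqj (generic-meets j))

    -- `True` brings `Positive` down from level `ℓ₂` to the level at which the cuts of `ℝ` live.
    P : Pred Carrier 0ℓ
    P x = True (em ℓ₂ {Positive x})

    isPositiveCone : IsPositiveCone P
    isPositiveCone = record
      { P-mono    = λ x≤y Px → fromWitness (Positive-mono x≤y (toWitness Px))
      ; P-nonneg  = λ 0≤x → fromWitness (Positive-nonneg 0≤x)
      ; P-+       = λ Px Py → fromWitness (Positive-+ (toWitness Px) (toWitness Py))
      ; P-∧0      = λ Px → fromWitness (Positive-∧0 (toWitness Px))
      ; 0≤u       = 0≤u
      ; ¬P-[-u]   = λ P-u → ¬Positive-[-u] (toWitness P-u)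
      }

    elements-located : ∀ a i → IsLocated isPositiveCone (elements u (R a) i)
    elements-located a i k =
      let n , (m , lower , upper) , _ = met a i k
      in m , fromWitness (n , lower) , fromWitness (n , upper)

    approached : ∀ a k → ∃ λ n → P (u - k · (v (R a) - s (R a) n))
    approached a k = let n , _ , m , near = met a 0 k in m , fromWitness (n , near)

    -- The Boolean functions are shown to code reals at located elements; all elements mentioned by
    -- the given relations are located.
    point : Point
    point x r = isYes (em 0ℓ {Above isPositiveCone x r})

    point-represents : ∀ {x} → IsLocated isPositiveCone x → Represents isPositiveCone (evaluate point x) x
    point-represents {x} loc = ≃cut⇒represents isPositiveCone loc
      (decode-≃ {point x} {cut isPositiveCone loc} λ r → fromWitness , toWitness)

    point-satisfies : ∀ a → Satisfied (evaluate point) (R a)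
    point-satisfies a = record
      { +-homo     = represents-+ isPositiveCone (rep 0) (rep 1) (rep 2)
      ; neg-homo   = represents-neg isPositiveCone (rep 0) (rep 3)
      ; 0-homo     = represents-0 isPositiveCone (rep 7)
      ; ∨-homo     = represents-∨ isPositiveCone (rep 0) (rep 1) (rep 4) (elements-located a 8)
      ; ∧-homo     = represents-∧ isPositiveCone (rep 0) (rep 1) (rep 5) (elements-located a 8)
      -- `trunc f` exceeds `f ∧ u` by a nonnegative element disjoint from `u`, so the difference and
      -- its negative are both in the cone.
      ; trunc-homo = represents-∧1 isPositiveCone (rep 0) (rep 6) (elements-located a 9)
          (fromWitness (Positive-nonneg (x≤y⇒0≤y-x (∧-unit≤trunc isUnit (f (R a))))))
          (fromWitness (Positive-mono (≤-reflexive (solve 2 (λ t z → ⊖ (t ⊝ z) ⊜ z ⊝ t) ≡.refl _ _))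
            (Positive-⟂ (x≤y⇒0≤y-x (∧-unit≤trunc isUnit (f (R a)))) (trunc-∧-⟂-unit isUnit (f (R a))))))
      ; sup-upper  = λ n → represents-≤ isPositiveCone (rep (11 ℕ.+ n)) (rep 10) (proj₁ (isSup (R a)) n)
      ; sup-least  = represents-sup isPositiveCone (rep 10) (λ n → rep (11 ℕ.+ n)) (approached a)
      }
      where
      rep : ∀ i → Represents isPositiveCone (evaluate point (elements u (R a) i)) (elements u (R a) i)
      rep i = point-represents (elements-located a i)

    -- `n · z - u` is the nonnegative `n · (z ⁺) - u` minus `n · ((- z) ⁺)`. The latter is disjoint
    -- from `n · (z ⁺)`, hence from `u`, so its negative is in the cone.
    point-separates : ∀ {n} → u ≤ n · ((f (R 0) - g (R 0)) ⁺) →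
                      ¬ (evaluate point (f (R 0)) ≤ℝ evaluate point (g (R 0)))
    point-separates {n} u≤nd = represents-≰ isPositiveCone
        (point-represents (elements-located 0 0)) (point-represents (elements-located 0 1)) n
        (fromWitness (Positive-mono (≤-reflexive decomposition)
          (Positive-+ (Positive-nonneg (x≤y⇒0≤y-x u≤nd)) (Positive-⟂ (·-nonneg n (0≤x⁺ (- z))) nm⟂u))))
      where
      z = f (R 0) - g (R 0)
      nm⟂u : n · ((- z) ⁺) ⟂ u
      nm⟂u = ⟂-sym (⟂-mono u≤nd ≤-refl (⟂-· n (·-nonneg n (0≤x⁺ z)) (0≤x⁺ (- z))
               (⟂-sym (⟂-· n (0≤x⁺ (- z)) (0≤x⁺ z) (⟂-sym (x⁺⟂[-x]⁺ z))))))
      decomposition : (n · (z ⁺) - u) + - (n · ((- z) ⁺)) ≈ n · z - u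
      decomposition =
        trans (+-congʳ (+-congʳ (trans (·-congʳ n (x⁺≈x+[-x]⁺ z)) (·-distrib-+ z ((- z) ⁺) n))))
          (solve 3 (λ z m u → ((z ⊕ m) ⊝ u) ⊕ ⊖ m ⊜ z ⊝ u) ≡.refl (n · z) (n · ((- z) ⁺)) u)

  -- The pair to be separated sits in the relation with index `0`, so its elements are located along
  -- with all the others.
  separating-point : ∀ R → ¬ (Relation.f (R 0) ≤ Relation.g (R 0)) →
    Σ[ x ∈ Point ] (∀ n → Satisfied (evaluate x) (R n))
      × ¬ (evaluate x (Relation.f (R 0)) ≤ℝ evaluate x (Relation.g (R 0)))
  separating-point R f≰g =
    let d = (Relation.f (R 0) - Relation.g (R 0)) ⁺
        u , isUnit , u≰0 , n , u≤nd = truncation-unit {d} (0≤x⁺ _)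
          (λ d≤0 → f≰g (y-x≤0⇒y≤x (≤-trans (x≤x⁺ _) d≤0)))
        module Pt = GenericPoint R isUnit u≰0
    in Pt.point , Pt.point-satisfies , Pt.point-separates {n} u≤nd

-- The σ-ideal and the embedding

module Representation
  (em : ∀ ℓ → ExcludedMiddle ℓ) {c ℓ₁ ℓ₂} (G : TruncatedℓGroup c ℓ₁ ℓ₂)
  (complete : DedekindσComplete (TruncatedℓGroup._≤_ G))
  where

  open TruncatedℓGroup G
  open ℓGroupProperties ℓGroup
  open Points em G complete
  open Satisfied
  open ℝ

  constant-supremum : ∀ {x y} → x ≈ y → IsSupremum _≤_ (λ _ → x) y
  constant-supremum x≈y = (λ _ → ≤-reflexive x≈y) , λ _ ub → ≤-trans (≤-reflexive (sym x≈y)) (ub 0)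

  operations : Carrier → Carrier → Relation
  operations f g = record { f = f ; g = g ; s = λ _ → 0# ; v = 0# ; isSup = constant-supremum refl }

  supremum-of : ∀ {s v} → IsSupremum _≤_ s v → Relation
  supremum-of {s} {v} isSup = record { f = 0# ; g = 0# ; s = s ; v = v ; isSup = isSup }

  Failing : Relation → Point → Set
  Failing R x = ¬ Satisfied (evaluate x) R

  I : σIdeal Point (c ⊔ ℓ₁ ⊔ ℓ₂)
  I = record
    { 𝓘        = λ A → Σ[ R ∈ (ℕ → Relation) ] (∀ x → A x → ∃ λ n → Failing (R n) x)
    ; ∅-closed = (λ _ → operations 0# 0#) , λ _ ()
    ; ⊆-closed = λ { A⊆B (R , covers) → R , λ x Ax → covers x (A⊆B Ax) }
    -- Each membership proof carries its sequence of relations, so merging them takes no countable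
    -- choice.
    ; ⋃-closed = λ A small →
        let R : ℕ × ℕ → Relation
            R (n , k) = proj₁ (small n) k
        in R ∘ unpair , λ { x (n , Anx) →
             let k , fails = proj₂ (small n) x Anx
                 j , eq    = unpair-surjective n k
             in j , ≡.subst (λ i → Failing (R i) x) (≡.sym eq) fails }
    }

  open σIdeal I
  open Quotient I using (_∼_; _≲_)

  stable : {A : Set} → ¬ ¬ A → A
  stable = decidable-stable (em 0ℓ)

  ι : Carrier → Point → ℝ
  ι f x = evaluate x f

  relation-small : ∀ R {A : Pred Point 0ℓ} → (∀ x → Satisfied (evaluate x) R → A x) → (λ x → ¬ A x) ∈ 𝓘
  relation-small R sat⇒A = (λ _ → R) , λ x ¬Ax → 0 , λ sat → ¬Ax (sat⇒A x sat)

  -- Points need not respect `_≈_`. But if `f ≈ g`, each of the two is a supremum of the constant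
  -- sequence at the other, so `sup-upper` gives both inequalities.
  ι-cong : ∀ {f g} → f ≈ g → ι f ∼ ι g
  ι-cong {f} {g} f≈g = ⊆-closed split
      (⋃-closed (λ n x → ¬ B n x) small)
    where
    B : ℕ → Pred Point 0ℓ
    B zero    x = ι f x ≤ℝ ι g x
    B (suc _) x = ι g x ≤ℝ ι f x
    split : ∀ {x} → ¬ (ι f x ≃ℝ ι g x) → ∃ λ n → ¬ (B n x)
    split {x} f≄g = stable λ none →
      f≄g (stable {A = B 0 x} (λ ¬f≤g → none (0 , ¬f≤g)) , stable {A = B 1 x} (λ ¬g≤f → none (1 , ¬g≤f)))
    small : ∀ n → (λ x → ¬ B n x) ∈ 𝓘
    small zero    = relation-small (supremum-of (constant-supremum f≈g)) {B 0} λ x sat → sup-upper sat 0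
    small (suc _) = relation-small (supremum-of (constant-supremum (sym f≈g))) {B 1} λ x sat → sup-upper sat 0

  -- Were `f ≰ g`, some point satisfying `operations f g` and all covering relations would separate
  -- them. It would lie in the covered set without failing any relation of the cover.
  ι-reflects-≤ : ∀ {f g} → ι f ≲ ι g → f ≤ g
  ι-reflects-≤ {f} {g} (R , covers) = decidable-stable (em ℓ₂) λ f≰g →
    let R′ : ℕ → Relation
        R′ = λ { zero → operations f g ; (suc n) → R n }
        x , satisfies , ιf≰ιg = separating-point R′ f≰g
        n , fails = covers x ιf≰ιg
    in fails (satisfies (suc n))

  ∼⇒≲ : ∀ {φ ψ} → φ ∼ ψ → φ ≲ ψ × ψ ≲ φ
  ∼⇒≲ φ∼ψ = ⊆-closed (λ ¬≤ ≃ → ¬≤ (proj₁ ≃)) φ∼ψ , ⊆-closed (λ ¬≥ ≃ → ¬≥ (proj₂ ≃)) φ∼ψ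

  ι-injective : ∀ {f g} → ι f ∼ ι g → f ≈ g
  ι-injective {f} {g} ιf∼ιg =
    let ιf≲ιg , ιg≲ιf = ∼⇒≲ {ι f} {ι g} ιf∼ιg in antisym (ι-reflects-≤ ιf≲ιg) (ι-reflects-≤ ιg≲ιf)

  -- For an arbitrary upper bound `φ`, a point with `ι v ≰ φ` violates either the least-upper-bound
  -- clause, listed at index `0`, or one of the bounds `ι (s n) ≤ φ`. These are countably many small
  -- sets.
  ι-σContinuous : σContinuous _≤_ _≲_ ι
  ι-σContinuous s v isSup =
      (λ n → relation-small (supremum-of isSup) {λ x → ι (s n) x ≤ℝ ι v x} λ x sat → sup-upper sat n)
    , λ φ bounded → ⊆-closed (split φ) (⋃-closed (λ n x → ¬ B φ n x) (small φ bounded))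
    where
    IsLeast : Point → Set
    IsLeast x = ∀ {r} → L (ι v x) r → ∃ λ n → L (ι (s n) x) r
    B : (Point → ℝ) → ℕ → Pred Point 0ℓ
    B φ zero    x = IsLeast x
    B φ (suc n) x = ι (s n) x ≤ℝ φ x
    small : ∀ φ → (∀ n → ι (s n) ≲ φ) → ∀ n → (λ x → ¬ B φ n x) ∈ 𝓘
    small φ bounded zero    = relation-small (supremum-of isSup) {IsLeast} λ x sat → sup-least sat
    small φ bounded (suc n) = bounded n
    split : ∀ φ {x} → ¬ (ι v x ≤ℝ φ x) → ∃ λ n → ¬ (B φ n x)
    split φ {x} v≰φ = stable λ none → v≰φ λ Lv →
      let n , Ls = stable {A = IsLeast x} (λ ¬least → none (0 , ¬least)) Lv
      in stable {A = ι (s n) x ≤ℝ φ x} (λ s≰φ → none (suc n , s≰φ)) Ls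

  isσEmbedding : IsσEmbedding G I ι
  isσEmbedding = record
    { isGroupHomomorphism = record
      { isMonoidHomomorphism = record
        { isMagmaHomomorphism = record
          { isRelHomomorphism = record { cong = ι-cong }
          ; homo = λ f g → relation-small (operations f g) λ _ → +-homo
          }
        ; ε-homo = relation-small (operations 0# 0#) λ _ → 0-homo
        }
      ; ⁻¹-homo = λ f → relation-small (operations f f) λ _ → neg-homo
      }
    ; isLatticeHomomorphism = record
      { isRelHomomorphism = record { cong = ι-cong }
      ; ∧-homo = λ f g → relation-small (operations f g) λ _ → ∧-homo
      ; ∨-homo = λ f g → relation-small (operations f g) λ _ → ∨-homo
      }
    ; injective = ι-injective
    ; σ-continuous = ι-σContinuous
    ; trunc-homo = λ f → relation-small (operations f f) λ _ → trunc-homo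
    }

theorem9p2 : (∀ ℓ → ExcludedMiddle ℓ) →
    ∀ {c ℓ₁ ℓ₂ : Level} (G : TruncatedℓGroup c ℓ₁ ℓ₂) →
    DedekindσComplete (TruncatedℓGroup._≤_ G) →
    Σ[ X ∈ Set c ] Σ[ I ∈ σIdeal X (c ⊔ ℓ₁ ⊔ ℓ₂) ]
    Σ[ ι ∈ (TruncatedℓGroup.Carrier G → X → ℝ) ] IsσEmbedding G I ι
theorem9p2 em G complete = Point , I , ι , isσEmbedding
  where
  open Points em G complete using (Point)
  open Representation em G complete using (I; ι; isσEmbedding)
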